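{- Let $T=\{3412,3421,2143\}$ and let $F_T(x)=\sum_{n\ge0}|S_n(T)|x^n$. Then $$F_T(x)=\frac{1-8x+23x^2-27x^3+12x^4-5x^5}{(1-3x+x^2)^3}.$$
   Context: $S_n$ is the set of permutations of $[n]$ ($S_0$ contains the empty permutation). A permutation avoids a pattern $\tau$ if it has no subsequence order-isomorphic to $\tau$; $S_n(T)$ is the set of permutations in $S_n$ avoiding every pattern in $T$. -}

module Defs where

open import Data.Bool using (Bool; true; false; _∧_; _∨_; not; if_then_else_)
open import Data.Bool using () renaming (_≟_ to _≟ᵇ_)
open import Data.Nat using (ℕ; zero; suc; _<ᵇ_; _≡ᵇ_)
open import Data.Integer using (ℤ; +_; -[1+_]; _+_; _*_; -_)
open import Data.List using (List; []; _∷_; map; concatMap; length; upTo; zip; sum; applyUpTo)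
open import Data.Product using (_,_)
open import Data.Bool.ListAction using (all; any)

-- Permutations of [n] in one-line notation, as lists of naturals.

words : ℕ → ℕ → List (List ℕ)
words m zero    = [] ∷ []
words m (suc k) = concatMap (λ w → map (λ i → suc i ∷ w) (upTo m)) (words m k)

notElem : ℕ → List ℕ → Bool
notElem x []       = true
notElem x (y ∷ ys) = not (x ≡ᵇ y) ∧ notElem x ys

distinct : List ℕ → Bool
distinct []       = true
distinct (x ∷ xs) = notElem x xs ∧ distinct xs

S : ℕ → List (List ℕ)
S n = filterᵇ (words n n)
  where
  filterᵇ : List (List ℕ) → List (List ℕ)
  filterᵇ []       = []
  filterᵇ (w ∷ ws) = if distinct w then w ∷ filterᵇ ws else filterᵇ ws

subseqs : {A : Set} → List A → List (List A)
subseqs []       = [] ∷ []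
subseqs (x ∷ xs) = map (x ∷_) (subseqs xs) Data.List.++ subseqs xs

-- order-isomorphism of two sequences of distinct numbers:
-- equal length and, for all positions i < j, (x_i < x_j) iff (y_i < y_j)
_==ᵇ_ : Bool → Bool → Bool
true  ==ᵇ b = b
false ==ᵇ b = not b

orderIso : List ℕ → List ℕ → Bool
orderIso []       []       = true
orderIso (x ∷ xs) (y ∷ ys) =
  all (λ { (x′ , y′) → (x <ᵇ x′) ==ᵇ (y <ᵇ y′) }) (zip xs ys) ∧ orderIso xs ys
orderIso _        _        = false

contains : List ℕ → List ℕ → Bool
contains σ τ = any (orderIso τ) (subseqs σ)

avoidsAll : List (List ℕ) → List ℕ → Bool
avoidsAll T σ = all (λ τ → not (contains σ τ)) T

countᵇ : {A : Set} → (A → Bool) → List A → ℕ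
countᵇ p []       = 0
countᵇ p (x ∷ xs) = if p x then suc (countᵇ p xs) else countᵇ p xs

numAvoiders : List (List ℕ) → ℕ → ℕ
numAvoiders T n = countᵇ (avoidsAll T) (S n)

-- Formal power series over ℤ as coefficient sequences; polynomials as
-- coefficient lists (constant term first).
Poly : Set
Poly = List ℤ

coeff : Poly → ℕ → ℤ
coeff []       _       = + 0
coeff (c ∷ cs) zero    = c
coeff (c ∷ cs) (suc n) = coeff cs n

_*ₚ_ : Poly → Poly → Poly
[]       *ₚ q = []
(c ∷ cs) *ₚ q = addₚ (map (c *_) q) (+ 0 ∷ (cs *ₚ q))
  where
  addₚ : Poly → Poly → Poly
  addₚ [] ys = ys
  addₚ xs [] = xs
  addₚ (x ∷ xs) (y ∷ ys) = (x + y) ∷ addₚ xs ys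

mulSeriesPolyCoeff : (ℕ → ℤ) → Poly → ℕ → ℤ
mulSeriesPolyCoeff f q n = go n 0
  where
  go : ℕ → ℕ → ℤ
  go zero    k = coeff q k * f 0
  go (suc m) k = coeff q k * f (suc m) + go m (suc k)
-- go m k = Σ_{j=0}^{m} q_{k+j} f_{m-j}; with k=0 this is the convolution

T : List (List ℕ)
T = (3 ∷ 4 ∷ 1 ∷ 2 ∷ []) ∷ (3 ∷ 4 ∷ 2 ∷ 1 ∷ []) ∷ (2 ∷ 1 ∷ 4 ∷ 3 ∷ []) ∷ []

F : ℕ → ℤ
F n = + numAvoiders T n

numerator : Poly
numerator = + 1 ∷ - (+ 8) ∷ + 23 ∷ - (+ 27) ∷ + 12 ∷ - (+ 5) ∷ []

baseDen : Poly
baseDen = + 1 ∷ - (+ 3) ∷ + 1 ∷ []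

denominator : Poly
denominator = baseDen *ₚ (baseDen *ₚ baseDen)

{-# OPTIONS --safe #-}
-- Build permutations leftwards: ins c w prepends a new letter to w with exactly c smaller letters.
-- Whether this keeps w T-avoiding depends only on how the letters ≤ c (low) and > c (high)
-- interleave in w.  For 2 ≤ c the site c is active iff it is "strong": the high letters increase
-- and at most one low letter follows a high one.  Prepending at c keeps the strong sites at or
-- above c (shifted by one) and destroys those below, so the avoiders form a generating tree whose
-- labels are the number of strong sites and three bits about sites 0 and 1.
--
-- In that tree the counts below a node are two-index arrays obeying
--   G (k+1) (m+1) = G k (m+1) + 2 G (k+1) m − G k m + R k m,
-- so their antidiagonal sums satisfy x (n+2) − 3 x (n+1) + x n = (lower-order terms).  The number
-- of avoiders is a combination of such sums and of the sums weighted by k, and three applications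
-- of that operator annihilate it.
module Submission where

open import Defs
open import Data.Bool.Base using (Bool; true; false; if_then_else_; not; _∧_; _∨_) renaming (T to Holds)
open import Data.Bool.ListAction using (all; any)
open import Data.Bool.Properties using (∧-zeroʳ; ∧-inverseʳ; ∨-assoc; ∨-identityʳ)
open import Data.Integer.Base using (ℤ; +_; _+_; _*_; -_; _-_)
open import Data.Integer.Properties as ℤ using (pos-+)
open import Data.Integer.Tactic.RingSolver using (solve-∀)
open import Data.List.Base using (List; []; _∷_; _++_; map; zip; length; concatMap; upTo; applyUpTo; cartesianProductWith)
open import Data.List.Membership.Propositional using (_∈_)
open import Data.List.Membership.Propositional.Properties
  using (∈-cartesianProductWith⁺; ∈-cartesianProductWith⁻; ∈-upTo⁺; ∈-upTo⁻)
open import Data.List.Membership.Propositional.Properties.WithK using (unique∧set⇒bag)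
open import Data.List.Properties using (∷-injective; ∷-injectiveˡ; ∷-injectiveʳ; length-map; map-++; map-∘; map-id-local)
open import Data.List.Relation.Binary.BagAndSetEquality using (∼bag⇒↭)
open import Data.List.Relation.Binary.Permutation.Propositional using (_↭_)
import Data.List.Relation.Binary.Permutation.Propositional.Properties as ↭
open import Data.List.Relation.Unary.All as All using (All; []; _∷_)
import Data.List.Relation.Unary.All.Properties as All
open import Data.List.Relation.Unary.AllPairs as AllPairs using ([]; _∷_)
import Data.List.Relation.Unary.AllPairs.Properties as AllPairs
open import Data.List.Relation.Unary.Any using (here; there)
open import Data.List.Relation.Unary.Unique.Propositional using (Unique)
import Data.List.Relation.Unary.Unique.Propositional.Properties as Unique
open import Data.Nat.Base as ℕ using (ℕ; zero; suc; pred; _≤_; _<_; _<ᵇ_; _≡ᵇ_; z≤n; s≤s)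
open import Data.Nat.ListAction using (sum)
open import Data.Nat.ListAction.Properties using (sum-++; sum-↭)
open import Data.Nat.Properties
open import Data.Product.Base using (_×_; _,_; proj₁)
open import Data.Sum.Base using (inj₁; inj₂)
open import Function.Base using (_∘_; case_of_)
open import Function.Bundles using (mk⇔)
open import Relation.Binary.PropositionalEquality
open import Relation.Nullary using (contradiction)
open ≡-Reasoning

-- The local functions of S and mulSeriesPolyCoeff have no name outside Defs; unification recovers
-- them, once the with-abstraction has made their arguments distinct variables.
mutual
  filterDistinct : ℕ → List (List ℕ) → List (List ℕ)
  filterDistinct = _

  S-filter : ∀ n → S n ≡ filterDistinct n (words n n)
  S-filter n with words n n
  ... | _ = refl

mutual
  convolution : (ℕ → ℤ) → Poly → ℕ → ℕ → ℕ → ℤ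
  convolution = _

  mulSeriesPolyCoeff-suc : ∀ f q n →
    mulSeriesPolyCoeff f q (suc n) ≡ coeff q 0 * f (suc n) + convolution f q (suc n) n 1
  mulSeriesPolyCoeff-suc f q n with suc n | 1
  ... | _ | _ = refl

-- Insertion and the enumeration of permutations

Holds⇒≡ : ∀ {b} → Holds b → b ≡ true
Holds⇒≡ {true} _ = refl

<⇒<ᵇ≡true : ∀ {a b} → a < b → (a <ᵇ b) ≡ true
<⇒<ᵇ≡true a<b = Holds⇒≡ (<⇒<ᵇ a<b)

≤⇒<ᵇ≡false : ∀ {a b} → b ≤ a → (a <ᵇ b) ≡ false
≤⇒<ᵇ≡false {a} {b} b≤a with a <ᵇ b in eq
... | false = refl
... | true  = contradiction (<ᵇ⇒< a b (subst Holds (sym eq) _)) (≤⇒≯ b≤a)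

<ᵇ≡false⇒≤ : ∀ {a b} → (a <ᵇ b) ≡ false → b ≤ a
<ᵇ≡false⇒≤ {a} {b} eq = ≮⇒≥ λ a<b → case trans (sym eq) (<⇒<ᵇ≡true a<b) of λ ()

<ᵇ≡true⇒< : ∀ {a b} → (a <ᵇ b) ≡ true → a < b
<ᵇ≡true⇒< {a} {b} eq = <ᵇ⇒< a b (subst Holds (sym eq) _)

bump : ℕ → ℕ → ℕ
bump c x = if c <ᵇ x then suc x else x

unbump : ℕ → ℕ → ℕ
unbump c x = if c <ᵇ x then pred x else x

ins : ℕ → List ℕ → List ℕ
ins c w = suc c ∷ map (bump c) w

bump-< : ∀ {c x} → c < x → bump c x ≡ suc x
bump-< c<x rewrite <⇒<ᵇ≡true c<x = refl

bump-≤ : ∀ {c x} → x ≤ c → bump c x ≡ x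
bump-≤ x≤c rewrite ≤⇒<ᵇ≡false x≤c = refl

-- Inserting at `c` splits the old site `c` into the new sites `c` and `suc c`. Hence both this
-- lemma, for the sites that keep their number, and `<ᵇ-bump->`, for those that move up by one,
-- include `b = c`.
<ᵇ-bump-≤ : ∀ {b c} → b ≤ c → ∀ x → (b <ᵇ bump c x) ≡ (b <ᵇ x)
<ᵇ-bump-≤ {b} {c} b≤c x with ≤-<-connex x c
... | inj₁ x≤c rewrite bump-≤ x≤c = refl
... | inj₂ c<x rewrite bump-< c<x =
  trans (<⇒<ᵇ≡true (m<n⇒m<1+n (≤-<-trans b≤c c<x))) (sym (<⇒<ᵇ≡true (≤-<-trans b≤c c<x)))

<ᵇ-bump-> : ∀ {b c} → c ≤ b → ∀ x → (suc b <ᵇ bump c x) ≡ (b <ᵇ x)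
<ᵇ-bump-> {b} {c} c≤b x with ≤-<-connex x c
... | inj₁ x≤c rewrite bump-≤ x≤c =
  trans (≤⇒<ᵇ≡false (m≤n⇒m≤1+n (≤-trans x≤c c≤b))) (sym (≤⇒<ᵇ≡false (≤-trans x≤c c≤b)))
... | inj₂ c<x rewrite bump-< c<x = refl

bump-<ᵇ : ∀ c x y → (bump c x <ᵇ bump c y) ≡ (x <ᵇ y)
bump-<ᵇ c x y with ≤-<-connex x c
... | inj₁ x≤c rewrite bump-≤ x≤c = <ᵇ-bump-≤ x≤c y
... | inj₂ c<x rewrite bump-< c<x = <ᵇ-bump-> (<⇒≤ c<x) y

bump-injective : ∀ {c x y} → bump c x ≡ bump c y → x ≡ y
bump-injective {c} {x} {y} eq = ≤-antisym (le x y (≤-reflexive eq)) (le y x (≤-reflexive (sym eq)))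
  where
  le : ∀ x y → bump c x ≤ bump c y → x ≤ y
  le x y p = <ᵇ≡false⇒≤ (trans (sym (bump-<ᵇ c y x)) (≤⇒<ᵇ≡false p))

bump-skips : ∀ c x → suc c ≢ bump c x
bump-skips c x eq with ≤-<-connex x c
... | inj₁ x≤c = <⇒≢ (s≤s x≤c) (sym (trans eq (bump-≤ x≤c)))
... | inj₂ c<x = <⇒≢ (s≤s c<x) (trans eq (bump-< c<x))

bump-unbump : ∀ {c x} → suc c ≢ x → bump c (unbump c x) ≡ x
bump-unbump {c} {x} ≢x with ≤-<-connex x c
... | inj₁ x≤c rewrite ≤⇒<ᵇ≡false x≤c = bump-≤ x≤c
bump-unbump {c} {suc x} ≢x | inj₂ c<x rewrite <⇒<ᵇ≡true c<x =
  bump-< (≤∧≢⇒< (≤-pred c<x) (≢x ∘ cong suc))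

ins-injective : ∀ {w v c d} → ins c w ≡ ins d v → w ≡ v × c ≡ d
ins-injective {w} {v} eq with ∷-injective eq
... | refl , eq′ = map-injective w v eq′ , refl
  where
  map-injective : ∀ {c} w v → map (bump c) w ≡ map (bump c) v → w ≡ v
  map-injective []      []      _  = refl
  map-injective (x ∷ w) (y ∷ v) eq =
    cong₂ _∷_ (bump-injective (∷-injectiveˡ eq)) (map-injective w v (∷-injectiveʳ eq))

-- Permutations generated by insertion

record IsPerm (n k : ℕ) (w : List ℕ) : Set where
  constructor isPerm
  field
    length≡ : length w ≡ k
    range   : All (λ x → 1 ≤ x × x ≤ n) w
    unique  : Unique w

perms : ℕ → List (List ℕ)
perms zero    = [] ∷ []
perms (suc n) = cartesianProductWith (λ w c → ins c w) (perms n) (upTo (suc n))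

perms-unique : ∀ n → Unique (perms n)
perms-unique zero    = [] ∷ []
perms-unique (suc n) =
  Unique.cartesianProductWith⁺ (λ w c → ins c w) ins-injective (perms-unique n) (Unique.upTo⁺ (suc n))

ins-isPerm : ∀ {n k c w} → c ≤ n → IsPerm n k w → IsPerm (suc n) (suc k) (ins c w)
ins-isPerm {n} {k} {c} {w} c≤n (isPerm len rng unq) = isPerm
  (cong suc (trans (length-map (bump c) w) len))
  ((s≤s z≤n , s≤s c≤n) ∷ All.map⁺ (All.map (λ {x} → bump-range x) rng))
  (All.map⁺ (All.universal (bump-skips c) w) ∷ Unique.map⁺ bump-injective unq)
  where
  bump-range : ∀ x → 1 ≤ x × x ≤ n → 1 ≤ bump c x × bump c x ≤ suc n
  bump-range x (1≤x , x≤n) with ≤-<-connex x c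
  ... | inj₁ x≤c rewrite bump-≤ x≤c = 1≤x , m≤n⇒m≤1+n x≤n
  ... | inj₂ c<x rewrite bump-< c<x = s≤s z≤n , s≤s x≤n

∈perms⇒isPerm : ∀ n {w} → w ∈ perms n → IsPerm n n w
∈perms⇒isPerm zero    (here refl) = isPerm refl [] []
∈perms⇒isPerm (suc n) w∈
  with v , c , v∈ , c∈ , refl ← ∈-cartesianProductWith⁻ (λ w c → ins c w) (perms n) (upTo (suc n)) w∈
  = ins-isPerm (≤-pred (∈-upTo⁻ c∈)) (∈perms⇒isPerm n v∈)

-- Removing the first letter `suc c` and closing the gap with `unbump` gives a permutation of one
-- size less, from which `ins c` rebuilds the word.
isPerm⇒∈perms : ∀ n {w} → IsPerm n n w → w ∈ perms n
isPerm⇒∈perms zero    {[]}        _ = here refl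
isPerm⇒∈perms (suc n) {suc c ∷ w} (isPerm len ((_ , c≤n) ∷ rng) (≢c ∷ unq)) =
  subst (λ v → suc c ∷ v ∈ perms (suc n)) ins-v
    (∈-cartesianProductWith⁺ (λ w c → ins c w) (isPerm⇒∈perms n v-isPerm) (∈-upTo⁺ c≤n))
  where
  v = map (unbump c) w

  ins-v : map (bump c) v ≡ w
  ins-v = trans (sym (map-∘ w)) (map-id-local (All.map bump-unbump ≢c))

  unbump-range : ∀ {x} → (suc c ≢ x) × (1 ≤ x × x ≤ suc n) → 1 ≤ unbump c x × unbump c x ≤ n
  unbump-range {x} (≢x , 1≤x , x≤n) with ≤-<-connex x c
  ... | inj₁ x≤c rewrite ≤⇒<ᵇ≡false x≤c = 1≤x , ≤-trans x≤c (≤-pred c≤n)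
  unbump-range {suc x} (≢x , _ , x≤n) | inj₂ c<x rewrite <⇒<ᵇ≡true c<x =
    ≤-trans (s≤s z≤n) (≤∧≢⇒< (≤-pred c<x) (≢x ∘ cong suc)) , ≤-pred x≤n

  v-isPerm : IsPerm n n v
  v-isPerm = isPerm
    (trans (length-map (unbump c) w) (suc-injective len))
    (All.map⁺ (All.map unbump-range (All.zip (≢c , rng))))
    (AllPairs.map (_∘ cong (bump c)) (AllPairs.map⁻ (subst Unique (sym ins-v) unq)))

words-cartesian : ∀ m k → words m (suc k) ≡ cartesianProductWith (λ w i → suc i ∷ w) (words m k) (upTo m)
words-cartesian m k = go (words m k)
  where
  go : ∀ ws → concatMap (λ w → map (λ i → suc i ∷ w) (upTo m)) ws
            ≡ cartesianProductWith (λ w i → suc i ∷ w) ws (upTo m)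
  go []       = refl
  go (w ∷ ws) = cong (map (λ i → suc i ∷ w) (upTo m) ++_) (go ws)

words-unique : ∀ m k → Unique (words m k)
words-unique m zero    = [] ∷ []
words-unique m (suc k) = subst Unique (sym (words-cartesian m k))
  (Unique.cartesianProductWith⁺ _ (λ { refl → refl , refl }) (words-unique m k) (Unique.upTo⁺ m))

∈words⇒ : ∀ m k {w} → w ∈ words m k → length w ≡ k × All (λ x → 1 ≤ x × x ≤ m) w
∈words⇒ m zero    (here refl) = refl , []
∈words⇒ m (suc k) w∈
  with v , i , v∈ , i∈ , refl ←
    ∈-cartesianProductWith⁻ _ (words m k) (upTo m) (subst (_ ∈_) (words-cartesian m k) w∈)
  with len , rng ← ∈words⇒ m k v∈
  = cong suc len , (s≤s z≤n , ∈-upTo⁻ i∈) ∷ rng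

⇒∈words : ∀ m k {w} → length w ≡ k → All (λ x → 1 ≤ x × x ≤ m) w → w ∈ words m k
⇒∈words m zero    {[]}        _   _                = here refl
⇒∈words m (suc k) {suc i ∷ w} len ((_ , i<m) ∷ rng) = subst (_ ∈_) (sym (words-cartesian m k))
  (∈-cartesianProductWith⁺ (λ w i → suc i ∷ w) (⇒∈words m k (suc-injective len) rng) (∈-upTo⁺ i<m))

notElem⇒≢ : ∀ x w → notElem x w ≡ true → All (x ≢_) w
notElem⇒≢ x []      _  = []
notElem⇒≢ x (y ∷ w) eq with x ≡ᵇ y in x≡ᵇy
... | false = (λ x≡y → subst Holds x≡ᵇy (≡⇒≡ᵇ x y x≡y)) ∷ notElem⇒≢ x w eq

≢⇒notElem : ∀ x w → All (x ≢_) w → notElem x w ≡ true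
≢⇒notElem x []      _            = refl
≢⇒notElem x (y ∷ w) (x≢y ∷ x≢w) with x ≡ᵇ y in x≡ᵇy
... | false = ≢⇒notElem x w x≢w
... | true  = contradiction (≡ᵇ⇒≡ x y (subst Holds (sym x≡ᵇy) _)) x≢y

distinct⇒Unique : ∀ w → distinct w ≡ true → Unique w
distinct⇒Unique []      _  = []
distinct⇒Unique (x ∷ w) eq with notElem x w in x∉w
... | true = notElem⇒≢ x w x∉w ∷ distinct⇒Unique w eq

Unique⇒distinct : ∀ w → Unique w → distinct w ≡ true
Unique⇒distinct []      _             = refl
Unique⇒distinct (x ∷ w) (x∉w ∷ unq) rewrite ≢⇒notElem x w x∉w = Unique⇒distinct w unq

∈filterDistinct⇒ : ∀ n ws {w} → w ∈ filterDistinct n ws → w ∈ ws × distinct w ≡ true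
∈filterDistinct⇒ n (v ∷ ws) w∈ with distinct v in eq | w∈
... | true  | here refl = here refl , eq
... | true  | there w∈′ = let p , q = ∈filterDistinct⇒ n ws w∈′ in there p , q
... | false | w∈′       = let p , q = ∈filterDistinct⇒ n ws w∈′ in there p , q

⇒∈filterDistinct : ∀ n ws {w} → w ∈ ws → distinct w ≡ true → w ∈ filterDistinct n ws
⇒∈filterDistinct n (v ∷ ws) (here refl) d rewrite d = here refl
⇒∈filterDistinct n (v ∷ ws) (there w∈)  d with distinct v
... | true  = there (⇒∈filterDistinct n ws w∈ d)
... | false = ⇒∈filterDistinct n ws w∈ d

filterDistinct-unique : ∀ n ws → Unique ws → Unique (filterDistinct n ws)
filterDistinct-unique n []       _            = []
filterDistinct-unique n (v ∷ ws) (v∉ws ∷ unq) with distinct v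
... | false = filterDistinct-unique n ws unq
... | true  =
  All.tabulate (λ w∈ → All.lookup v∉ws (proj₁ (∈filterDistinct⇒ n ws w∈))) ∷ filterDistinct-unique n ws unq

-- The two enumerations run in different orders, but both are duplicate-free and have the same
-- members.
S↭perms : ∀ n → S n ↭ perms n
S↭perms n rewrite S-filter n = ∼bag⇒↭ (unique∧set⇒bag
  (filterDistinct-unique n _ (words-unique n n)) (perms-unique n) (mk⇔ to from))
  where
  to : ∀ {w} → w ∈ filterDistinct n (words n n) → w ∈ perms n
  to {w} w∈ with w∈words , d ← ∈filterDistinct⇒ n (words n n) w∈
            with len , rng ← ∈words⇒ n n w∈words
    = isPerm⇒∈perms n (isPerm len rng (distinct⇒Unique w d))
  from : ∀ {w} → w ∈ perms n → w ∈ filterDistinct n (words n n)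
  from {w} w∈ with isPerm len rng unq ← ∈perms⇒isPerm n w∈
    = ⇒∈filterDistinct n _ (⇒∈words n n len rng) (Unique⇒distinct w unq)

sumOver : {A : Set} → (A → ℕ) → List A → ℕ
sumOver h xs = sum (map h xs)

countᵇ-sumOver : {A : Set} (p : A → Bool) (xs : List A) →
                 countᵇ p xs ≡ sumOver (λ x → if p x then 1 else 0) xs
countᵇ-sumOver p []       = refl
countᵇ-sumOver p (x ∷ xs) with p x
... | true  = cong suc (countᵇ-sumOver p xs)
... | false = countᵇ-sumOver p xs

countᵇ-↭ : {A : Set} (p : A → Bool) {xs ys : List A} → xs ↭ ys → countᵇ p xs ≡ countᵇ p ys
countᵇ-↭ p {xs} {ys} xs↭ys = begin
  countᵇ p xs                             ≡⟨ countᵇ-sumOver p xs ⟩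
  sumOver (λ x → if p x then 1 else 0) xs ≡⟨ sum-↭ (↭.map⁺ _ xs↭ys) ⟩
  sumOver (λ x → if p x then 1 else 0) ys ≡⟨ countᵇ-sumOver p ys ⟨
  countᵇ p ys                             ∎

-- Avoidance and active sites

private variable
  A B : Set

any-++ : (p : A → Bool) (xs ys : List A) → any p (xs ++ ys) ≡ any p xs ∨ any p ys
any-++ p []       ys = refl
any-++ p (x ∷ xs) ys = trans (cong (p x ∨_) (any-++ p xs ys)) (sym (∨-assoc (p x) _ _))

any-map : (f : A → B) {p : B → Bool} {q : A → Bool} → (∀ x → p (f x) ≡ q x) →
          ∀ xs → any p (map f xs) ≡ any q xs
any-map f eq []       = refl
any-map f eq (x ∷ xs) = cong₂ _∨_ (eq x) (any-map f eq xs)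

any-cong : {p q : A → Bool} → (∀ x → p x ≡ q x) → ∀ xs → any p xs ≡ any q xs
any-cong eq []       = refl
any-cong eq (x ∷ xs) = cong₂ _∨_ (eq x) (any-cong eq xs)

any-false : {p : A → Bool} → (∀ x → p x ≡ false) → ∀ xs → any p xs ≡ false
any-false eq []       = refl
any-false eq (x ∷ xs) = cong₂ _∨_ (eq x) (any-false eq xs)

anyPair : (A → A → Bool) → List A → Bool
anyPair r []       = false
anyPair r (x ∷ xs) = any (r x) xs ∨ anyPair r xs

anyTriple : (A → A → A → Bool) → List A → Bool
anyTriple r []       = false
anyTriple r (x ∷ xs) = anyPair (r x) xs ∨ anyTriple r xs

anyPair-map : (f : A → B) {r : B → B → Bool} {s : A → A → Bool} →
              (∀ x y → r (f x) (f y) ≡ s x y) → ∀ xs → anyPair r (map f xs) ≡ anyPair s xs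
anyPair-map f eq []       = refl
anyPair-map f eq (x ∷ xs) = cong₂ _∨_ (any-map f (eq x) xs) (anyPair-map f eq xs)

anyPair-cong : {r s : A → A → Bool} → (∀ x y → r x y ≡ s x y) → ∀ xs → anyPair r xs ≡ anyPair s xs
anyPair-cong eq []       = refl
anyPair-cong eq (x ∷ xs) = cong₂ _∨_ (any-cong (eq x) xs) (anyPair-cong eq xs)

anyPair-false : {r : A → A → Bool} → (∀ x y → r x y ≡ false) → ∀ xs → anyPair r xs ≡ false
anyPair-false eq []       = refl
anyPair-false eq (x ∷ xs) = cong₂ _∨_ (any-false (eq x) xs) (anyPair-false eq xs)

anyTriple-map : (f : A → B) {r : B → B → B → Bool} {s : A → A → A → Bool} →
                (∀ x y z → r (f x) (f y) (f z) ≡ s x y z) → ∀ xs → anyTriple r (map f xs) ≡ anyTriple s xs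
anyTriple-map f eq []       = refl
anyTriple-map f eq (x ∷ xs) = cong₂ _∨_ (anyPair-map f (eq x) xs) (anyTriple-map f eq xs)

anyTriple-cong : {r s : A → A → A → Bool} → (∀ x y z → r x y z ≡ s x y z) →
                 ∀ xs → anyTriple r xs ≡ anyTriple s xs
anyTriple-cong eq []       = refl
anyTriple-cong eq (x ∷ xs) = cong₂ _∨_ (anyPair-cong (eq x) xs) (anyTriple-cong eq xs)

∨-interchange : ∀ a b c d → (a ∨ b) ∨ (c ∨ d) ≡ (a ∨ c) ∨ (b ∨ d)
∨-interchange true  _     _     _ = refl
∨-interchange false true  true  _ = refl
∨-interchange false true  false _ = refl
∨-interchange false false _     _ = refl

any-∨ : (p q : A → Bool) → ∀ xs → any p xs ∨ any q xs ≡ any (λ x → p x ∨ q x) xs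
any-∨ p q []       = refl
any-∨ p q (x ∷ xs) =
  trans (∨-interchange (p x) _ (q x) _) (cong ((p x ∨ q x) ∨_) (any-∨ p q xs))

anyPair-∨ : (r s : A → A → Bool) → ∀ xs → anyPair r xs ∨ anyPair s xs ≡ anyPair (λ x y → r x y ∨ s x y) xs
anyPair-∨ r s []       = refl
anyPair-∨ r s (x ∷ xs) =
  trans (∨-interchange (any (r x) xs) _ _ _) (cong₂ _∨_ (any-∨ (r x) (s x) xs) (anyPair-∨ r s xs))

anyTriple-∨ : (r s : A → A → A → Bool) → ∀ xs →
              anyTriple r xs ∨ anyTriple s xs ≡ anyTriple (λ x y z → r x y z ∨ s x y z) xs
anyTriple-∨ r s []       = refl
anyTriple-∨ r s (x ∷ xs) =
  trans (∨-interchange (anyPair (r x) xs) _ _ _) (cong₂ _∨_ (anyPair-∨ (r x) (s x) xs) (anyTriple-∨ r s xs))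

anyPair-∧ : ∀ b {r s : A → A → Bool} → (∀ x y → r x y ≡ b ∧ s x y) → ∀ xs → anyPair r xs ≡ b ∧ anyPair s xs
anyPair-∧ true  eq xs = anyPair-cong eq xs
anyPair-∧ false eq xs = anyPair-false eq xs

-- Pattern occurrences as loops over positions

any-subseqs-∷ : (p : List A → Bool) (x : A) (xs : List A) →
                any p (subseqs (x ∷ xs)) ≡ any (p ∘ (x ∷_)) (subseqs xs) ∨ any p (subseqs xs)
any-subseqs-∷ p x xs = trans (any-++ p (map (x ∷_) (subseqs xs)) (subseqs xs))
  (cong (_∨ any p (subseqs xs)) (any-map (x ∷_) (λ _ → refl) (subseqs xs)))

-- `contains` ranges over all subsequences, but `orderIso τ` rejects those whose length is not that
-- of `τ`. Under this condition the search collapses to a loop over single positions, pairs or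
-- triples, peeling off one letter at a time with `onlyLength-∷`.
OnlyLength : ℕ → (List A → Bool) → Set
OnlyLength n p = ∀ s → length s ≢ n → p s ≡ false

onlyLength-∷ : ∀ {n} {p : List A → Bool} → OnlyLength (suc n) p → ∀ x → OnlyLength n (p ∘ (x ∷_))
onlyLength-∷ only x s ≢n = only (x ∷ s) (≢n ∘ suc-injective)

any-subseqs₀ : {p : List A → Bool} → OnlyLength 0 p → ∀ xs → any p (subseqs xs) ≡ p []
any-subseqs₀ only []       = ∨-identityʳ _
any-subseqs₀ {p = p} only (x ∷ xs) = trans (any-subseqs-∷ p x xs)
  (cong₂ _∨_ (any-false (λ s → only (x ∷ s) λ ()) (subseqs xs)) (any-subseqs₀ only xs))

any-subseqs₁ : {p : List A → Bool} → OnlyLength 1 p → ∀ xs → any p (subseqs xs) ≡ any (λ x → p (x ∷ [])) xs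
any-subseqs₁ only []       = trans (∨-identityʳ _) (only [] λ ())
any-subseqs₁ {p = p} only (x ∷ xs) = trans (any-subseqs-∷ p x xs)
  (cong₂ _∨_ (any-subseqs₀ (onlyLength-∷ only x) xs) (any-subseqs₁ only xs))

any-subseqs₂ : {p : List A → Bool} → OnlyLength 2 p → ∀ xs →
               any p (subseqs xs) ≡ anyPair (λ x y → p (x ∷ y ∷ [])) xs
any-subseqs₂ only []       = trans (∨-identityʳ _) (only [] λ ())
any-subseqs₂ {p = p} only (x ∷ xs) = trans (any-subseqs-∷ p x xs)
  (cong₂ _∨_ (any-subseqs₁ (onlyLength-∷ only x) xs) (any-subseqs₂ only xs))

any-subseqs₃ : {p : List A → Bool} → OnlyLength 3 p → ∀ xs →
               any p (subseqs xs) ≡ anyTriple (λ x y z → p (x ∷ y ∷ z ∷ [])) xs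
any-subseqs₃ only []       = trans (∨-identityʳ _) (only [] λ ())
any-subseqs₃ {p = p} only (x ∷ xs) = trans (any-subseqs-∷ p x xs)
  (cong₂ _∨_ (any-subseqs₂ (onlyLength-∷ only x) xs) (any-subseqs₃ only xs))

orderIso-length : ∀ xs ys → length ys ≢ length xs → orderIso xs ys ≡ false
orderIso-length []       []       ≢ = contradiction refl ≢
orderIso-length []       (_ ∷ _)  ≢ = refl
orderIso-length (_ ∷ _)  []       ≢ = refl
orderIso-length (x ∷ xs) (y ∷ ys) ≢
  rewrite orderIso-length xs ys (≢ ∘ cong suc) = ∧-zeroʳ _

all-zip-map : (f : A → A) {p q : B × A → Bool} → (∀ x y → p (x , f y) ≡ q (x , y)) →
              ∀ xs ys → all p (zip xs (map f ys)) ≡ all q (zip xs ys)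
all-zip-map f eq []       ys       = refl
all-zip-map f eq (x ∷ xs) []       = refl
all-zip-map f eq (x ∷ xs) (y ∷ ys) = cong₂ _∧_ (eq x y) (all-zip-map f eq xs ys)

module _ {f : ℕ → ℕ} (f-<ᵇ : ∀ x y → (f x <ᵇ f y) ≡ (x <ᵇ y)) where

  orderIso-map : ∀ xs ys → orderIso xs (map f ys) ≡ orderIso xs ys
  orderIso-map []       []       = refl
  orderIso-map []       (_ ∷ _)  = refl
  orderIso-map (_ ∷ _)  []       = refl
  orderIso-map (x ∷ xs) (y ∷ ys) = cong₂ _∧_
    (all-zip-map f (λ x′ y′ → cong ((x <ᵇ x′) ==ᵇ_) (f-<ᵇ y y′)) xs ys) (orderIso-map xs ys)

  any-subseqs-map : {p q : List ℕ → Bool} → (∀ s → p (map f s) ≡ q s) →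
                    ∀ w → any p (subseqs (map f w)) ≡ any q (subseqs w)
  any-subseqs-map eq []      = cong (_∨ false) (eq [])
  any-subseqs-map {p} {q} eq (x ∷ w) = begin
    any p (subseqs (f x ∷ map f w))                                      ≡⟨ any-subseqs-∷ p (f x) (map f w) ⟩
    any (p ∘ (f x ∷_)) (subseqs (map f w)) ∨ any p (subseqs (map f w))
      ≡⟨ cong₂ _∨_ (any-subseqs-map (eq ∘ (x ∷_)) w) (any-subseqs-map eq w) ⟩
    any (q ∘ (x ∷_)) (subseqs w) ∨ any q (subseqs w)                     ≡⟨ any-subseqs-∷ q x w ⟨
    any q (subseqs (x ∷ w))                                              ∎

  avoidsAll-map : ∀ τs w → avoidsAll τs (map f w) ≡ avoidsAll τs w
  avoidsAll-map []       w = refl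
  avoidsAll-map (τ ∷ τs) w =
    cong₂ (λ b c → not b ∧ c) (any-subseqs-map (orderIso-map τ) w) (avoidsAll-map τs w)

-- Sites and the avoidance condition for a new first letter

lowPair highDescent : ℕ → List ℕ → Bool
lowPair     a = anyPair λ x y → not (a <ᵇ x) ∧ not (a <ᵇ y)
highDescent a = anyPair λ x y → (a <ᵇ x) ∧ (a <ᵇ y) ∧ not (x <ᵇ y)

-- A new first letter exceeding exactly the letters ≤ a would play the 3 of a 3412 or 3421
-- (starts34), respectively the 2 of a 2143 (starts21).
starts34 starts21 : ℕ → List ℕ → Bool
starts34 a = anyTriple λ x y z → (a <ᵇ x) ∧ not (a <ᵇ y) ∧ not (a <ᵇ z)
starts21 a = anyTriple λ x y z → not (a <ᵇ x) ∧ (a <ᵇ y) ∧ (a <ᵇ z) ∧ not (y <ᵇ z)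

active : ℕ → List ℕ → Bool
active a w = not (starts34 a w) ∧ not (starts21 a w)

contains-∷ : ∀ x w t τ → length τ ≡ 3 →
  contains (x ∷ w) (t ∷ τ) ≡ anyTriple (λ y z u → orderIso (t ∷ τ) (x ∷ y ∷ z ∷ u ∷ [])) w ∨ contains w (t ∷ τ)
contains-∷ x w t τ len = trans (any-subseqs-∷ (orderIso (t ∷ τ)) x w)
  (cong (_∨ contains w (t ∷ τ)) (any-subseqs₃ (λ s ≢3 →
    orderIso-length (t ∷ τ) (x ∷ s) λ eq → ≢3 (trans (suc-injective eq) len)) w))

-- The two patterns differ only in the order of their last two letters, so their union imposes no
-- condition on `c` against `d`. The comparisons of `b` with `c` and `d` follow from those with `x`.
orderIso-34 : ∀ x b c d →
  orderIso (3 ∷ 4 ∷ 1 ∷ 2 ∷ []) (x ∷ b ∷ c ∷ d ∷ []) ∨ orderIso (3 ∷ 4 ∷ 2 ∷ 1 ∷ []) (x ∷ b ∷ c ∷ d ∷ [])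
  ≡ (x <ᵇ b) ∧ not (x <ᵇ c) ∧ not (x <ᵇ d)
orderIso-34 x b c d with x <ᵇ b in x<b | x <ᵇ c in x<c | x <ᵇ d in x<d
... | false | _     | _     = refl
... | true  | true  | _     = refl
... | true  | false | true  = refl
... | true  | false | false
  rewrite ≤⇒<ᵇ≡false (≤-trans (<ᵇ≡false⇒≤ {x} {c} x<c) (<⇒≤ (<ᵇ≡true⇒< {x} {b} x<b)))
        | ≤⇒<ᵇ≡false (≤-trans (<ᵇ≡false⇒≤ {x} {d} x<d) (<⇒≤ (<ᵇ≡true⇒< {x} {b} x<b)))
  with c <ᵇ d
... | true  = refl
... | false = refl

orderIso-21 : ∀ x b c d →
  orderIso (2 ∷ 1 ∷ 4 ∷ 3 ∷ []) (x ∷ b ∷ c ∷ d ∷ [])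
  ≡ not (x <ᵇ b) ∧ (x <ᵇ c) ∧ (x <ᵇ d) ∧ not (c <ᵇ d)
orderIso-21 x b c d with x <ᵇ b in x<b | x <ᵇ c in x<c | x <ᵇ d in x<d
... | true  | _     | _     = refl
... | false | false | _     = refl
... | false | true  | false = refl
... | false | true  | true
  rewrite <⇒<ᵇ≡true (≤-<-trans (<ᵇ≡false⇒≤ {x} {b} x<b) (<ᵇ≡true⇒< {x} {c} x<c))
        | <⇒<ᵇ≡true (≤-<-trans (<ᵇ≡false⇒≤ {x} {b} x<b) (<ᵇ≡true⇒< {x} {d} x<d))
  with c <ᵇ d
... | true  = refl
... | false = refl

-- A pattern occurrence in `x ∷ w` either lies in `w` or uses `x` as its first letter. The second
-- kind is what `active` excludes, 3412 and 3421 being merged by `orderIso-34`.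
avoids-∷ : ∀ x w → avoidsAll T (x ∷ w) ≡ avoidsAll T w ∧ active x w
avoids-∷ x w
  rewrite contains-∷ x w 3 (4 ∷ 1 ∷ 2 ∷ []) refl
        | contains-∷ x w 3 (4 ∷ 2 ∷ 1 ∷ []) refl
        | contains-∷ x w 2 (1 ∷ 4 ∷ 3 ∷ []) refl
        | sym (anyTriple-cong (orderIso-34 x) w)
        | sym (anyTriple-cong (orderIso-21 x) w)
        | sym (anyTriple-∨ (λ y z u → orderIso (3 ∷ 4 ∷ 1 ∷ 2 ∷ []) (x ∷ y ∷ z ∷ u ∷ []))
                           (λ y z u → orderIso (3 ∷ 4 ∷ 2 ∷ 1 ∷ []) (x ∷ y ∷ z ∷ u ∷ [])) w)
  = rearrange (starting (3 ∷ 4 ∷ 1 ∷ 2 ∷ [])) (starting (3 ∷ 4 ∷ 2 ∷ 1 ∷ [])) (starting (2 ∷ 1 ∷ 4 ∷ 3 ∷ []))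
      (contains w (3 ∷ 4 ∷ 1 ∷ 2 ∷ [])) (contains w (3 ∷ 4 ∷ 2 ∷ 1 ∷ [])) (contains w (2 ∷ 1 ∷ 4 ∷ 3 ∷ []))
  where
  starting : List ℕ → Bool
  starting τ = anyTriple (λ y z u → orderIso τ (x ∷ y ∷ z ∷ u ∷ [])) w

  rearrange : ∀ a b c a′ b′ c′ →
    not (a ∨ a′) ∧ not (b ∨ b′) ∧ not (c ∨ c′) ∧ true
    ≡ (not a′ ∧ not b′ ∧ not c′ ∧ true) ∧ not (a ∨ b) ∧ not c
  rearrange true  true  _     a′    b′    c′   = sym (∧-zeroʳ _)
  rearrange true  false _     a′    b′    c′   = sym (∧-zeroʳ _)
  rearrange false b     c     true  b′    c′   = refl
  rearrange false true  _     false b′    c′   = sym (∧-zeroʳ _)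
  rearrange false false c     false true  c′   = refl
  rearrange false false true  false false c′   = sym (∧-zeroʳ _)
  rearrange false false false false false true = refl
  rearrange false false false false false false = refl

-- Low letters and the activity of a site

lows : ℕ → List ℕ → ℕ
lows a = countᵇ λ x → not (a <ᵇ x)

-- The consequence of being a permutation of `[n]` on which the analysis of sites rests: the number
-- of a site is its number of low letters.
Balanced : ℕ → List ℕ → Set
Balanced n w = ∀ {a} → a ≤ n → lows a w ≡ a

countᵇ-map : (f : A → B) {p : B → Bool} {q : A → Bool} → (∀ x → p (f x) ≡ q x) →
             ∀ xs → countᵇ p (map f xs) ≡ countᵇ q xs
countᵇ-map f eq []       = refl
countᵇ-map f {q = q} eq (x ∷ xs) rewrite eq x =
  cong (λ k → if q x then suc k else k) (countᵇ-map f eq xs)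

ins-balanced : ∀ {n c} w → c ≤ n → Balanced n w → Balanced (suc n) (ins c w)
ins-balanced {n} {c} w c≤n bal {a} a≤ with ≤-<-connex a c
... | inj₁ a≤c rewrite <⇒<ᵇ≡true (s≤s a≤c) =
  trans (countᵇ-map (bump c) (λ x → cong not (<ᵇ-bump-≤ a≤c x)) w) (bal (≤-trans a≤c c≤n))
ins-balanced {n} {c} w c≤n bal {suc a} (s≤s a≤n) | inj₂ (s≤s c≤a) rewrite ≤⇒<ᵇ≡false c≤a =
  cong suc (trans (countᵇ-map (bump c) (λ x → cong not (<ᵇ-bump-> c≤a x)) w) (bal a≤n))

any-low : ∀ a w → any (λ x → not (a <ᵇ x)) w ≡ (0 <ᵇ lows a w)
any-low a []      = refl
any-low a (x ∷ w) with a <ᵇ x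
... | true  = any-low a w
... | false = refl

lowPair-lows : ∀ a w → lowPair a w ≡ (1 <ᵇ lows a w)
lowPair-lows a []      = refl
lowPair-lows a (x ∷ w) with a <ᵇ x
... | true  = trans (cong (_∨ lowPair a w) (any-false (λ _ → refl) w)) (lowPair-lows a w)
... | false = trans (cong₂ _∨_ (any-low a w) (lowPair-lows a w)) (absorb (lows a w))
  where
  absorb : ∀ k → (0 <ᵇ k) ∨ (1 <ᵇ k) ≡ (0 <ᵇ k)
  absorb zero    = refl
  absorb (suc k) = refl

starts34-∷ : ∀ a x w → starts34 a (x ∷ w) ≡ ((a <ᵇ x) ∧ lowPair a w) ∨ starts34 a w
starts34-∷ a x w = cong (_∨ starts34 a w) (anyPair-∧ (a <ᵇ x) (λ _ _ → refl) w)

starts21-∷ : ∀ a x w → starts21 a (x ∷ w) ≡ (not (a <ᵇ x) ∧ highDescent a w) ∨ starts21 a w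
starts21-∷ a x w = cong (_∨ starts21 a w) (anyPair-∧ (not (a <ᵇ x)) (λ _ _ → refl) w)

¬lowPair⇒¬starts34 : ∀ a w → lowPair a w ≡ false → starts34 a w ≡ false
¬lowPair⇒¬starts34 a []      _ = refl
¬lowPair⇒¬starts34 a (x ∷ w) eq with any (λ y → not (a <ᵇ x) ∧ not (a <ᵇ y)) w
... | false = trans (starts34-∷ a x w)
  (cong₂ _∨_ (trans (cong ((a <ᵇ x) ∧_) eq) (∧-zeroʳ _)) (¬lowPair⇒¬starts34 a w eq))

¬highDescent⇒¬starts21 : ∀ a w → highDescent a w ≡ false → starts21 a w ≡ false
¬highDescent⇒¬starts21 a []      _ = refl
¬highDescent⇒¬starts21 a (x ∷ w) eq with any (λ y → (a <ᵇ x) ∧ (a <ᵇ y) ∧ not (x <ᵇ y)) w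
... | false = trans (starts21-∷ a x w)
  (cong₂ _∨_ (trans (cong (not (a <ᵇ x) ∧_) eq) (∧-zeroʳ _)) (¬highDescent⇒¬starts21 a w eq))

few-lows⇒¬starts34 : ∀ a w → lows a w ≤ 1 → starts34 a w ≡ false
few-lows⇒¬starts34 a w ≤1 = ¬lowPair⇒¬starts34 a w (trans (lowPair-lows a w) (≤⇒<ᵇ≡false ≤1))

no-lows⇒¬starts21 : ∀ a w → lows a w ≡ 0 → starts21 a w ≡ false
no-lows⇒¬starts21 a []      _ = refl
no-lows⇒¬starts21 a (x ∷ w) eq with a <ᵇ x
... | true = cong₂ _∨_ (anyPair-false (λ _ _ → refl) w) (no-lows⇒¬starts21 a w eq)

strong : ℕ → List ℕ → Bool
strong a w = not (starts34 a w) ∧ not (highDescent a w)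

-- With a single low letter `starts34` is impossible, so at site 1 only `starts21` has to be
-- excluded.
weak : List ℕ → Bool
weak w = not (starts21 1 w)

active-0 : ∀ w → lows 0 w ≡ 0 → active 0 w ≡ true
active-0 w eq rewrite few-lows⇒¬starts34 0 w (≤-trans (≤-reflexive eq) z≤n) | no-lows⇒¬starts21 0 w eq = refl

active-1 : ∀ w → lows 1 w ≡ 1 → active 1 w ≡ weak w
active-1 w eq rewrite few-lows⇒¬starts34 1 w (≤-reflexive eq) = refl

-- The first letter decides. If it is high, the low letters behind it, at least two, complete a
-- `starts34`, and both sides are false. If it is low, every descent of high letters completes a
-- `starts21` with it.
active-≥2 : ∀ a w → 2 ≤ a → lows a w ≡ a → active a w ≡ strong a w
active-≥2 a []      () refl
active-≥2 a (x ∷ w) 2≤a eq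
  rewrite starts34-∷ a x w | starts21-∷ a x w with a <ᵇ x
... | true  rewrite lowPair-lows a w | eq | <⇒<ᵇ≡true 2≤a = refl
... | false rewrite any-false {p = λ (_ : ℕ) → false} (λ _ → refl) w with highDescent a w in hd
...   | true  = refl
...   | false rewrite ¬highDescent⇒¬starts21 a w hd = refl

-- Effect of an insertion on the sites

starts34-bump-≤ : ∀ {b c} → b ≤ c → ∀ w → starts34 b (map (bump c) w) ≡ starts34 b w
starts34-bump-≤ {b} {c} b≤c w = anyTriple-map (bump c)
  (λ x y z → cong₂ _∧_ (<ᵇ-bump-≤ b≤c x) (cong₂ (λ p q → not p ∧ not q) (<ᵇ-bump-≤ b≤c y) (<ᵇ-bump-≤ b≤c z))) w

lowPair-bump-≤ : ∀ {b c} → b ≤ c → ∀ w → lowPair b (map (bump c) w) ≡ lowPair b w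
lowPair-bump-≤ {b} {c} b≤c w = anyPair-map (bump c)
  (λ x y → cong₂ (λ p q → not p ∧ not q) (<ᵇ-bump-≤ b≤c x) (<ᵇ-bump-≤ b≤c y)) w

starts21-bump-≤ : ∀ {b c} → b ≤ c → ∀ w → starts21 b (map (bump c) w) ≡ starts21 b w
starts21-bump-≤ {b} {c} b≤c w = anyTriple-map (bump c)
  (λ x y z → cong₂ (λ p q → not p ∧ q) (<ᵇ-bump-≤ b≤c x) (cong₂ _∧_ (<ᵇ-bump-≤ b≤c y)
    (cong₂ (λ p q → p ∧ not q) (<ᵇ-bump-≤ b≤c z) (bump-<ᵇ c y z)))) w

highDescent-bump-≤ : ∀ {b c} → b ≤ c → ∀ w → highDescent b (map (bump c) w) ≡ highDescent b w
highDescent-bump-≤ {b} {c} b≤c w = anyPair-map (bump c)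
  (λ y z → cong₂ _∧_ (<ᵇ-bump-≤ b≤c y)
    (cong₂ (λ p q → p ∧ not q) (<ᵇ-bump-≤ b≤c z) (bump-<ᵇ c y z))) w

starts34-bump-> : ∀ {b c} → c ≤ b → ∀ w → starts34 (suc b) (map (bump c) w) ≡ starts34 b w
starts34-bump-> {b} {c} c≤b w = anyTriple-map (bump c)
  (λ x y z → cong₂ _∧_ (<ᵇ-bump-> c≤b x) (cong₂ (λ p q → not p ∧ not q) (<ᵇ-bump-> c≤b y) (<ᵇ-bump-> c≤b z))) w

starts21-bump-> : ∀ {b c} → c ≤ b → ∀ w → starts21 (suc b) (map (bump c) w) ≡ starts21 b w
starts21-bump-> {b} {c} c≤b w = anyTriple-map (bump c)
  (λ x y z → cong₂ (λ p q → not p ∧ q) (<ᵇ-bump-> c≤b x) (cong₂ _∧_ (<ᵇ-bump-> c≤b y)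
    (cong₂ (λ p q → p ∧ not q) (<ᵇ-bump-> c≤b z) (bump-<ᵇ c y z)))) w

highDescent-bump-> : ∀ {b c} → c ≤ b → ∀ w → highDescent (suc b) (map (bump c) w) ≡ highDescent b w
highDescent-bump-> {b} {c} c≤b w = anyPair-map (bump c)
  (λ y z → cong₂ _∧_ (<ᵇ-bump-> c≤b y)
    (cong₂ (λ p q → p ∧ not q) (<ᵇ-bump-> c≤b z) (bump-<ᵇ c y z))) w

avoids-ins : ∀ c w → avoidsAll T (ins c w) ≡ avoidsAll T w ∧ active c w
avoids-ins c w = trans (avoids-∷ (suc c) (map (bump c) w)) (cong₂ _∧_
  (avoidsAll-map (bump-<ᵇ c) T w)
  (cong₂ (λ p q → not p ∧ not q) (starts34-bump-> ≤-refl w) (starts21-bump-> ≤-refl w)))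

-- The new letter is low at site `suc e`, and a low letter begins neither a `starts34` nor a descent
-- of high letters.
strong-ins-> : ∀ {c e} → c ≤ e → ∀ w → strong (suc e) (ins c w) ≡ strong e w
strong-ins-> {c} {e} c≤e w
  rewrite starts34-∷ (suc e) (suc c) (map (bump c) w) | ≤⇒<ᵇ≡false c≤e
        | any-false {p = λ (_ : ℕ) → false} (λ _ → refl) (map (bump c) w)
        | starts34-bump-> c≤e w | highDescent-bump-> c≤e w = refl

any-between : ∀ b c w → any (λ x → (b <ᵇ x) ∧ not (c <ᵇ x)) w ≡ false → lows c w ≤ lows b w
any-between b c []      _ = z≤n
any-between b c (x ∷ w) eq with b <ᵇ x | c <ᵇ x
... | true  | true  = any-between b c w eq
... | false | true  = m≤n⇒m≤1+n (any-between b c w eq)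
... | false | false = s≤s (any-between b c w eq)

highDescent-ins : ∀ {b c} → b ≤ c → ∀ w →
  highDescent b (ins c w) ≡ any (λ x → (b <ᵇ x) ∧ not (c <ᵇ x)) w ∨ highDescent b w
highDescent-ins {b} {c} b≤c w = cong₂ _∨_
  (any-map (bump c) (λ x → cong₂ _∧_ (<⇒<ᵇ≡true (s≤s b≤c))
    (cong₂ (λ p q → p ∧ not q) (<ᵇ-bump-≤ b≤c x) (<ᵇ-bump-> ≤-refl x))) w)
  (highDescent-bump-≤ b≤c w)

-- Since `w` has `c` letters up to `c` but only `b` up to `b`, some letter lies above `b` and not
-- above `c`. The new letter exceeds and precedes it: a descent of letters that are high at site
-- `b`.
strong-ins-< : ∀ {n b c} w → Balanced n w → c ≤ n → b < c → strong b (ins c w) ≡ false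
strong-ins-< {b = b} {c} w bal c≤n b<c
  rewrite highDescent-ins (<⇒≤ b<c) w with any (λ x → (b <ᵇ x) ∧ not (c <ᵇ x)) w in eq
... | true  = ∧-zeroʳ _
... | false = contradiction
  (subst₂ _≤_ (bal c≤n) (bal (≤-trans (<⇒≤ b<c) c≤n)) (any-between b c w eq)) (<⇒≱ b<c)

starts34-ins : ∀ {b c} → b ≤ c → ∀ w → starts34 b (ins c w) ≡ lowPair b w ∨ starts34 b w
starts34-ins {b} {c} b≤c w
  rewrite starts34-∷ b (suc c) (map (bump c) w) | <⇒<ᵇ≡true (s≤s b≤c)
        | lowPair-bump-≤ b≤c w | starts34-bump-≤ b≤c w = refl

-- The new letter is high at site `c` and stands before at least two low letters.
strong-ins-≥2 : ∀ {n c} w → Balanced n w → c ≤ n → 2 ≤ c → strong c (ins c w) ≡ false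
strong-ins-≥2 {n} {c} w bal c≤n 2≤c
  rewrite starts34-ins (≤-refl {c}) w | lowPair-lows c w | bal c≤n | <⇒<ᵇ≡true 2≤c = refl

-- The new letter is the smallest high letter at site `c`, so it begins no descent, and at most one
-- low letter follows it, too few for a `starts34`.
strong-ins-≤1 : ∀ {n c} w → Balanced n w → c ≤ n → c ≤ 1 → strong c (ins c w) ≡ strong c w
strong-ins-≤1 {n} {c} w bal c≤n c≤1
  rewrite starts34-ins (≤-refl {c}) w | lowPair-lows c w | bal c≤n | ≤⇒<ᵇ≡false c≤1
        | highDescent-ins (≤-refl {c}) w
        | any-false {p = λ x → (c <ᵇ x) ∧ not (c <ᵇ x)} (λ x → ∧-inverseʳ (c <ᵇ x)) w = refl

weak-ins-suc : ∀ c w → weak (ins (suc c) w) ≡ weak w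
weak-ins-suc c w = cong not (trans (starts21-∷ 1 (suc (suc c)) (map (bump (suc c)) w))
  (starts21-bump-≤ (s≤s z≤n) w))

-- The new letter 1 is the only low letter at site 1 and stands first, so site 1 is active exactly
-- when the old letters, all of them high, contain no descent.
weak-ins-0 : ∀ w → lows 0 w ≡ 0 → weak (ins 0 w) ≡ strong 0 w
weak-ins-0 w eq
  rewrite starts21-∷ 1 1 (map (bump 0) w) | highDescent-bump-> {0} z≤n w | starts21-bump-> {0} z≤n w
        | no-lows⇒¬starts21 0 w eq | few-lows⇒¬starts34 0 w (≤-trans (≤-reflexive eq) z≤n)
  = cong not (∨-identityʳ _)

-- The generating tree

toℕ : Bool → ℕ
toℕ b = if b then 1 else 0

sumFrom : (ℕ → ℕ) → ℕ → ℕ → ℕ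
sumFrom f lo zero      = 0
sumFrom f lo (suc len) = f lo ℕ.+ sumFrom f (suc lo) len

countFrom : (ℕ → Bool) → ℕ → ℕ → ℕ
countFrom p = sumFrom (toℕ ∘ p)

sumFrom-+ : ∀ f lo l₁ l₂ → sumFrom f lo (l₁ ℕ.+ l₂) ≡ sumFrom f lo l₁ ℕ.+ sumFrom f (lo ℕ.+ l₁) l₂
sumFrom-+ f lo zero     l₂ = cong (λ a → sumFrom f a l₂) (sym (+-identityʳ lo))
sumFrom-+ f lo (suc l₁) l₂ = begin
  f lo ℕ.+ sumFrom f (suc lo) (l₁ ℕ.+ l₂)
    ≡⟨ cong (f lo ℕ.+_) (sumFrom-+ f (suc lo) l₁ l₂) ⟩
  f lo ℕ.+ (sumFrom f (suc lo) l₁ ℕ.+ sumFrom f (suc lo ℕ.+ l₁) l₂)    ≡⟨ +-assoc (f lo) _ _ ⟨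
  f lo ℕ.+ sumFrom f (suc lo) l₁ ℕ.+ sumFrom f (suc lo ℕ.+ l₁) l₂
    ≡⟨ cong (λ a → f lo ℕ.+ sumFrom f (suc lo) l₁ ℕ.+ sumFrom f a l₂) (+-suc lo l₁) ⟨
  f lo ℕ.+ sumFrom f (suc lo) l₁ ℕ.+ sumFrom f (lo ℕ.+ suc l₁) l₂      ∎

sumFrom-cong-shift : ∀ {f g lo lo′} len → (∀ i → i < len → f (lo ℕ.+ i) ≡ g (lo′ ℕ.+ i)) →
                     sumFrom f lo len ≡ sumFrom g lo′ len
sumFrom-cong-shift zero eq = refl
sumFrom-cong-shift {f} {g} {lo} {lo′} (suc len) eq = cong₂ ℕ._+_
  (subst₂ (λ a b → f a ≡ g b) (+-identityʳ lo) (+-identityʳ lo′) (eq 0 (s≤s z≤n)))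
  (sumFrom-cong-shift len λ i i<len →
    subst₂ (λ a b → f a ≡ g b) (+-suc lo i) (+-suc lo′ i) (eq (suc i) (s≤s i<len)))

sumFrom-zero : ∀ f lo len → (∀ i → i < len → f (lo ℕ.+ i) ≡ 0) → sumFrom f lo len ≡ 0
sumFrom-zero f lo zero eq = refl
sumFrom-zero f lo (suc len) eq = cong₂ ℕ._+_
  (subst (λ a → f a ≡ 0) (+-identityʳ lo) (eq 0 (s≤s z≤n)))
  (sumFrom-zero f (suc lo) len λ i i<len → subst (λ a → f a ≡ 0) (+-suc lo i) (eq (suc i) (s≤s i<len)))

sumOver-applyUpTo : ∀ {A : Set} (h : A → ℕ) (e : ℕ → A) f lo n → (∀ i → i < n → h (e i) ≡ f (lo ℕ.+ i)) →
                    sumOver h (applyUpTo e n) ≡ sumFrom f lo n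
sumOver-applyUpTo h e f lo zero    eq = refl
sumOver-applyUpTo h e f lo (suc n) eq = cong₂ ℕ._+_
  (trans (eq 0 (s≤s z≤n)) (cong f (+-identityʳ lo)))
  (sumOver-applyUpTo h (e ∘ suc) f (suc lo) n λ i i<n → trans (eq (suc i) (s≤s i<n)) (cong f (+-suc lo i)))

partialSum : (ℕ → ℕ) → ℕ → ℕ
partialSum f zero    = 0
partialSum f (suc k) = partialSum f k ℕ.+ f (suc k)

-- The j-th true position from the top of the range sees exactly j true positions at or above it.
sumFrom-ranks : ∀ (p : ℕ → Bool) (X : ℕ → ℕ) lo len →
  (f : ℕ → ℕ) → (∀ a l → lo ≤ a → a ℕ.+ l ≡ lo ℕ.+ len → 0 < l →
    f a ≡ (if p a then X (countFrom p a l) else 0)) →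
  sumFrom f lo len ≡ partialSum X (countFrom p lo len)
sumFrom-ranks p X lo zero      f eq = refl
sumFrom-ranks p X lo (suc len) f eq
  rewrite eq lo (suc len) ≤-refl refl (s≤s z≤n)
        | sumFrom-ranks p X (suc lo) len f
            (λ a l lo<a al → eq a l (<⇒≤ lo<a) (trans al (sym (+-suc lo len))))
  with p lo
... | true  = +-comm _ (partialSum X (countFrom p (suc lo) len))
... | false = refl

-- A node of the generating tree: k counts the strong sites ≥ 2; z, o, v say whether
-- site 0 is strong, site 1 is strong, site 1 is active.  descendants k z o v m counts
-- the nodes m levels below.
descendants : ℕ → Bool → Bool → Bool → ℕ → ℕ
descendants k z o v zero    = 1
descendants k z o v (suc m) =
  descendants (toℕ o ℕ.+ k) z z z m
  ℕ.+ ((if v then descendants (toℕ o ℕ.+ k) false o true m else 0)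
  ℕ.+ partialSum (λ j → descendants j false false v m) k)

-- Here w is meant to have n + 1 letters, so that its sites ≥ 2 are 2, …, n + 1.
nodeCount : ℕ → ℕ → List ℕ → ℕ
nodeCount m n w =
  if avoidsAll T w
  then descendants (countFrom (λ a → strong a w) 2 n) (strong 0 w) (strong 1 w) (weak w) m
  else 0

-- The label comes in through equations so that each kind of child can supply it in the form in
-- which `descendants` computes it.
nodeCount-ins : ∀ m n c w {b k z o v} → avoidsAll T w ≡ true → active c w ≡ b →
  countFrom (λ a → strong a (ins c w)) 2 n ≡ k →
  strong 0 (ins c w) ≡ z → strong 1 (ins c w) ≡ o → weak (ins c w) ≡ v →
  nodeCount m n (ins c w) ≡ (if b then descendants k z o v m else 0)
nodeCount-ins m n c w av refl refl refl refl refl rewrite avoids-ins c w | av = refl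

module _ {n} w (bal : Balanced (suc n) w) where

  strongs : ℕ → ℕ → ℕ
  strongs = countFrom (λ a → strong a w)

  -- The sites from 2 on of the child are the old sites from 1 on, moved up by one, so the old site
  -- 1 now enters the count.
  strongs-ins-≤1 : ∀ {c} → c ≤ 1 → countFrom (λ a → strong a (ins c w)) 2 (suc n) ≡ toℕ (strong 1 w) ℕ.+ strongs 2 n
  strongs-ins-≤1 {c} c≤1 = sumFrom-cong-shift {lo = 2} {lo′ = 1} (suc n)
    (λ i _ → cong toℕ (strong-ins-> {c} {suc i} (≤-trans c≤1 (s≤s z≤n)) w))

  site-≤ : ∀ i l → i ℕ.+ l ≡ n → 0 < l → 2 ℕ.+ i ≤ suc n
  site-≤ i l refl 0<l = s≤s (m<m+n i 0<l)

  -- In the child no site from 2 up to the insertion point `2 + i` is strong; the sites from `3 + i`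
  -- on copy the old sites from `2 + i` on.
  strongs-ins-≥2 : ∀ i l → i ℕ.+ l ≡ n → 0 < l →
    countFrom (λ a → strong a (ins (2 ℕ.+ i) w)) 2 (suc n) ≡ strongs (2 ℕ.+ i) l
  strongs-ins-≥2 i l refl 0<l = begin
    countFrom p 2 (suc i ℕ.+ l)                    ≡⟨ sumFrom-+ (toℕ ∘ p) 2 (suc i) l ⟩
    countFrom p 2 (suc i) ℕ.+ countFrom p (3 ℕ.+ i) l ≡⟨ cong₂ ℕ._+_ low high ⟩
    strongs (2 ℕ.+ i) l                             ∎
    where
    p : ℕ → Bool
    p a = strong a (ins (2 ℕ.+ i) w)
    c≤n = site-≤ i l refl 0<l
    not-strong : ∀ a → a ≤ i → strong (2 ℕ.+ a) (ins (2 ℕ.+ i) w) ≡ false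
    not-strong a a≤i with m≤n⇒m<n∨m≡n a≤i
    ... | inj₁ a<i  = strong-ins-< w bal c≤n (s≤s (s≤s a<i))
    ... | inj₂ refl = strong-ins-≥2 w bal c≤n (s≤s (s≤s z≤n))
    low : countFrom p 2 (suc i) ≡ 0
    low = sumFrom-zero (toℕ ∘ p) 2 (suc i) λ j j<si → cong toℕ (not-strong j (≤-pred j<si))
    high : countFrom p (3 ℕ.+ i) l ≡ strongs (2 ℕ.+ i) l
    high = sumFrom-cong-shift l λ j _ → cong toℕ (strong-ins-> {2 ℕ.+ i} {2 ℕ.+ i ℕ.+ j} (m≤m+n (2 ℕ.+ i) j) w)

  -- Insertions at 0, at 1 and at 2 or above match the three summands of `descendants`. When `w`
  -- does not avoid `T`, no child does.
  nodeCount-children : ∀ m → sumFrom (λ c → nodeCount m (suc n) (ins c w)) 0 (2 ℕ.+ n) ≡ nodeCount (suc m) n w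
  nodeCount-children m with avoidsAll T w in av
  ... | false = sumFrom-zero _ 0 (2 ℕ.+ n) λ c _ → dead c
    where
    dead : ∀ c → nodeCount m (suc n) (ins c w) ≡ 0
    dead c rewrite avoids-ins c w | av = refl
  ... | true = cong₂ ℕ._+_ child-0 (cong₂ ℕ._+_ child-1 children-≥2)
    where
    k = strongs 2 n

    child-0 : nodeCount m (suc n) (ins 0 w) ≡
              descendants (toℕ (strong 1 w) ℕ.+ k) (strong 0 w) (strong 0 w) (strong 0 w) m
    child-0 = nodeCount-ins m (suc n) 0 w av (active-0 w (bal z≤n)) (strongs-ins-≤1 z≤n)
      (strong-ins-≤1 w bal z≤n z≤n) (strong-ins-> {0} z≤n w) (weak-ins-0 w (bal z≤n))

    child-1 : nodeCount m (suc n) (ins 1 w) ≡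
              (if weak w then descendants (toℕ (strong 1 w) ℕ.+ k) false (strong 1 w) true m else 0)
    child-1 with weak w in v
    -- An inactive child contributes 0 whatever its label, so the label is left to `refl`.
    ... | false = nodeCount-ins m (suc n) 1 w av (trans (active-1 w (bal (s≤s z≤n))) v) refl refl refl refl
    ... | true  = nodeCount-ins m (suc n) 1 w av (trans (active-1 w (bal (s≤s z≤n))) v)
      (strongs-ins-≤1 ≤-refl) (strong-ins-< w bal (s≤s z≤n) (s≤s z≤n))
      (strong-ins-≤1 w bal (s≤s z≤n) ≤-refl) (trans (weak-ins-suc 0 w) v)

    child-≥2 : ∀ i l → i ℕ.+ l ≡ n → 0 < l → nodeCount m (suc n) (ins (2 ℕ.+ i) w) ≡
      (if strong (2 ℕ.+ i) w then descendants (strongs (2 ℕ.+ i) l) false false (weak w) m else 0)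
    child-≥2 i l il 0<l = nodeCount-ins m (suc n) (2 ℕ.+ i) w av
      (active-≥2 (2 ℕ.+ i) w (s≤s (s≤s z≤n)) (bal c≤n)) (strongs-ins-≥2 i l il 0<l)
      (strong-ins-< w bal c≤n (s≤s z≤n)) (strong-ins-< w bal c≤n (s≤s (s≤s z≤n))) (weak-ins-suc (suc i) w)
      where c≤n = site-≤ i l il 0<l

    children-≥2 : sumFrom (λ c → nodeCount m (suc n) (ins c w)) 2 n ≡
                  partialSum (λ j → descendants j false false (weak w) m) k
    children-≥2 = sumFrom-ranks (λ a → strong a w) _ 2 n _ λ where
      (suc zero) _ (s≤s ()) _ _
      (suc (suc i)) l _ il 0<l → child-≥2 i l (suc-injective (suc-injective il)) 0<l

-- From the tree to the number of avoiders

sumOver-cartesian : ∀ {A B C : Set} (f : A → B → C) (h : C → ℕ) xs ys →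
  sumOver h (cartesianProductWith f xs ys) ≡ sumOver (λ x → sumOver (h ∘ f x) ys) xs
sumOver-cartesian f h []       ys = refl
sumOver-cartesian f h (x ∷ xs) ys = begin
  sum (map h (map (f x) ys ++ cartesianProductWith f xs ys))
    ≡⟨ cong sum (map-++ h (map (f x) ys) _) ⟩
  sum (map h (map (f x) ys) ++ map h (cartesianProductWith f xs ys))
    ≡⟨ sum-++ (map h (map (f x) ys)) _ ⟩
  sum (map h (map (f x) ys)) ℕ.+ sumOver h (cartesianProductWith f xs ys)
    ≡⟨ cong₂ ℕ._+_ (cong sum (sym (map-∘ ys))) (sumOver-cartesian f h xs ys) ⟩
  sumOver (h ∘ f x) ys ℕ.+ sumOver (λ x → sumOver (h ∘ f x) ys) xs               ∎

sumOver-cong : ∀ {A : Set} {f g : A → ℕ} xs → (∀ {x} → x ∈ xs → f x ≡ g x) → sumOver f xs ≡ sumOver g xs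
sumOver-cong []       eq = refl
sumOver-cong (x ∷ xs) eq = cong₂ ℕ._+_ (eq (here refl)) (sumOver-cong xs (eq ∘ there))

perms-balanced : ∀ n {w} → w ∈ perms n → Balanced n w
perms-balanced zero    (here refl) z≤n = refl
perms-balanced (suc n) w∈
  with v , c , v∈ , c∈ , refl ← ∈-cartesianProductWith⁻ (λ w c → ins c w) (perms n) (upTo (suc n)) w∈
  = ins-balanced v (≤-pred (∈-upTo⁻ c∈)) (perms-balanced n v∈)

-- Each step of the induction trades one letter of the permutations for one level of descent. The
-- base is the one-letter word, whose sites 0 and 1 are strong and which has no site above 1.
sum-nodeCount : ∀ n m → sumOver (nodeCount m n) (perms (suc n)) ≡ descendants 0 true true true (n ℕ.+ m)
sum-nodeCount zero    m = +-identityʳ _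
sum-nodeCount (suc n) m = begin
  sumOver (nodeCount m (suc n)) (perms (2 ℕ.+ n))
    ≡⟨ sumOver-cartesian (λ w c → ins c w) (nodeCount m (suc n)) (perms (suc n)) (upTo (2 ℕ.+ n)) ⟩
  sumOver (λ w → sumOver (λ c → nodeCount m (suc n) (ins c w)) (upTo (2 ℕ.+ n))) (perms (suc n))
    ≡⟨ sumOver-cong (perms (suc n)) (λ {w} w∈ → trans
         (sumOver-applyUpTo _ (λ i → i) (λ c → nodeCount m (suc n) (ins c w)) 0 (2 ℕ.+ n) (λ _ _ → refl))
         (nodeCount-children w (perms-balanced (suc n) w∈) m)) ⟩
  sumOver (nodeCount (suc m) n) (perms (suc n))
    ≡⟨ sum-nodeCount n (suc m) ⟩
  descendants 0 true true true (n ℕ.+ suc m)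
    ≡⟨ cong (descendants 0 true true true) (+-suc n m) ⟩
  descendants 0 true true true (suc n ℕ.+ m) ∎

numAvoiders-suc : ∀ n → numAvoiders T (suc n) ≡ descendants 0 true true true n
numAvoiders-suc n = begin
  countᵇ (avoidsAll T) (S (suc n))           ≡⟨ countᵇ-↭ (avoidsAll T) (S↭perms (suc n)) ⟩
  countᵇ (avoidsAll T) (perms (suc n))       ≡⟨ countᵇ-sumOver (avoidsAll T) (perms (suc n)) ⟩
  -- `nodeCount 0` is the indicator of avoidance, each node being its only descendant at level 0.
  sumOver (nodeCount 0 n) (perms (suc n))    ≡⟨ sum-nodeCount n 0 ⟩
  descendants 0 true true true (n ℕ.+ 0)       ≡⟨ cong (descendants 0 true true true) (+-identityʳ n) ⟩
  descendants 0 true true true n             ∎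

-- Antidiagonal sums and the recurrence

Array : Set
Array = ℕ → ℕ → ℤ

diag : Array → ℕ → ℤ
diag G zero    = G 0 0
diag G (suc n) = G 0 (suc n) + diag (G ∘ suc) n

diag-cong : ∀ {G H} → (∀ k m → G k m ≡ H k m) → ∀ n → diag G n ≡ diag H n
diag-cong eq zero    = eq 0 0
diag-cong eq (suc n) = cong₂ _+_ (eq 0 (suc n)) (diag-cong (eq ∘ suc) n)

+-interchange : ∀ a b c d → (a + b) + (c + d) ≡ (a + c) + (b + d)
+-interchange = solve-∀

diag-+ : ∀ G H n → diag (λ k m → G k m + H k m) n ≡ diag G n + diag H n
diag-+ G H zero    = refl
diag-+ G H (suc n) = trans (cong (λ x → G 0 (suc n) + H 0 (suc n) + x) (diag-+ (G ∘ suc) (H ∘ suc) n))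
  (+-interchange (G 0 (suc n)) (H 0 (suc n)) (diag (G ∘ suc) n) (diag (H ∘ suc) n))

diag-neg : ∀ G n → diag (λ k m → - G k m) n ≡ - diag G n
diag-neg G zero    = refl
diag-neg G (suc n) = trans (cong (λ x → - G 0 (suc n) + x) (diag-neg (G ∘ suc) n))
  (sym (ℤ.neg-distrib-+ (G 0 (suc n)) (diag (G ∘ suc) n)))

diag-- : ∀ G H n → diag (λ k m → G k m - H k m) n ≡ diag G n - diag H n
diag-- G H n = trans (diag-+ G (λ k m → - H k m) n) (cong (λ x → diag G n + x) (diag-neg H n))

-- `diag` splits off its entry with first index 0; here the entry at the opposite end, with second
-- index 0, is split off.
diag-shiftʳ : ∀ G n → diag G (suc n) ≡ diag (λ k m → G k (suc m)) n + G (suc n) 0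
diag-shiftʳ G zero    = refl
diag-shiftʳ G (suc n) = begin
  G 0 (suc (suc n)) + diag (G ∘ suc) (suc n)
    ≡⟨ cong (λ x → G 0 (suc (suc n)) + x) (diag-shiftʳ (G ∘ suc) n) ⟩
  G 0 (suc (suc n)) + (diag (λ k m → G (suc k) (suc m)) n + G (suc (suc n)) 0)
    ≡⟨ ℤ.+-assoc (G 0 (suc (suc n))) _ _ ⟨
  G 0 (suc (suc n)) + diag (λ k m → G (suc k) (suc m)) n + G (suc (suc n)) 0        ∎

diag-shiftˡ : ∀ G → (∀ m → G 0 m ≡ + 0) → ∀ n → diag (G ∘ suc) n ≡ diag G (suc n)
diag-shiftˡ G G₀ n =
  sym (trans (cong (_+ diag (G ∘ suc) n) (G₀ (suc n))) (ℤ.+-identityˡ (diag (G ∘ suc) n)))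

diag-stepˡ : ∀ G → (∀ m → G 0 m ≡ + 0) → ∀ n →
  diag (λ k m → G (suc k) m - G k m) n ≡ diag G (suc n) - diag G n
diag-stepˡ G G₀ n = trans (diag-- (G ∘ suc) G n) (cong (_- diag G n) (diag-shiftˡ G G₀ n))

diag-stepʳ : ∀ G n → diag (λ k m → G k (suc m) - G k m) n ≡ diag G (suc n) - G (suc n) 0 - diag G n
diag-stepʳ G n = trans (diag-- (λ k m → G k (suc m)) G n) (cong (_- diag G n)
  (trans (add-sub (diag (λ k m → G k (suc m)) n) (G (suc n) 0)) (cong (_- G (suc n) 0) (sym (diag-shiftʳ G n)))))
  where
  add-sub : ∀ a b → a ≡ a + b - b
  add-sub = solve-∀

weighted : Array → Array
weighted G k m = + k * G k m

-- The coefficient of index `n + 2` in the product of the series `x` with `baseDen`.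
L : (ℕ → ℤ) → ℕ → ℤ
L x n = x (2 ℕ.+ n) - + 3 * x (1 ℕ.+ n) + x n

L-cong : ∀ {x y} → (∀ n → x n ≡ y n) → ∀ n → L x n ≡ L y n
L-cong eq n = cong₂ _+_ (cong₂ (λ p q → p - + 3 * q) (eq (2 ℕ.+ n)) (eq (1 ℕ.+ n))) (eq n)

module _ (G R : Array) (G₀ : ∀ m → G 0 m ≡ + 0)
         (G-rec : ∀ k m → G (suc k) (suc m) ≡ G k (suc m) + (G (suc k) m + G (suc k) m) - G k m + R k m) where

  -- Summing `G-rec` over an antidiagonal turns shifts of either index into shifts of `n`: the
  -- once-shifted terms give `diag G (suc n)` three times in all. Shifts of the second index leave
  -- boundary values at `m = 0`; shifts of the first leave none, since `G 0` vanishes.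
  L-diag : ∀ n → L (diag G) n ≡ G (2 ℕ.+ n) 0 - G (1 ℕ.+ n) 0 + diag R n
  L-diag n = begin
    diag G (2 ℕ.+ n) - + 3 * D₁ + D
      ≡⟨ cong (λ x → x - + 3 * D₁ + D) (sym (diag-shiftˡ G G₀ (suc n))) ⟩
    diag (G ∘ suc) (suc n) - + 3 * D₁ + D
      ≡⟨ cong (λ x → x - + 3 * D₁ + D) (trans (diag-shiftʳ (G ∘ suc) n) (cong (_+ g₂) diag-rec)) ⟩
    (diag (λ k m → G k (suc m)) n + (D₁ + D₁) - D + diag R n) + g₂ - + 3 * D₁ + D
      ≡⟨ cong (λ x → (diag (λ k m → G k (suc m)) n + (D₁ + D₁) - D + diag R n) + g₂ - + 3 * x + D) (diag-shiftʳ G n) ⟩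
    (E + (D₁ + D₁) - D + diag R n) + g₂ - + 3 * (E + g₁) + D
      ≡⟨ cong (λ x → (E + (x + x) - D + diag R n) + g₂ - + 3 * (E + g₁) + D) (diag-shiftʳ G n) ⟩
    (E + ((E + g₁) + (E + g₁)) - D + diag R n) + g₂ - + 3 * (E + g₁) + D
      ≡⟨ cancel E g₁ g₂ D (diag R n) ⟩
    g₂ - g₁ + diag R n ∎
    where
    D = diag G n
    D₁ = diag G (suc n)
    E = diag (λ k m → G k (suc m)) n
    g₁ = G (1 ℕ.+ n) 0
    g₂ = G (2 ℕ.+ n) 0

    cancel : ∀ E g₁ g₂ D r → (E + ((E + g₁) + (E + g₁)) - D + r) + g₂ - + 3 * (E + g₁) + D ≡ g₂ - g₁ + r
    cancel = solve-∀

    diag-rec : diag (λ k m → G (suc k) (suc m)) n ≡ E + (D₁ + D₁) - D + diag R n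
    diag-rec = begin
      diag (λ k m → G (suc k) (suc m)) n
        ≡⟨ diag-cong G-rec n ⟩
      diag (λ k m → G k (suc m) + (G (suc k) m + G (suc k) m) - G k m + R k m) n
        ≡⟨ diag-+ (λ k m → G k (suc m) + (G (suc k) m + G (suc k) m) - G k m) R n ⟩
      diag (λ k m → G k (suc m) + (G (suc k) m + G (suc k) m) - G k m) n + diag R n
        ≡⟨ cong (_+ diag R n) (diag-- (λ k m → G k (suc m) + (G (suc k) m + G (suc k) m)) G n) ⟩
      diag (λ k m → G k (suc m) + (G (suc k) m + G (suc k) m)) n - D + diag R n
        ≡⟨ cong (λ x → x - D + diag R n) (diag-+ (λ k m → G k (suc m)) (λ k m → G (suc k) m + G (suc k) m) n) ⟩
      E + diag (λ k m → G (suc k) m + G (suc k) m) n - D + diag R n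
        ≡⟨ cong (λ x → E + x - D + diag R n) (diag-+ (G ∘ suc) (G ∘ suc) n) ⟩
      E + (diag (G ∘ suc) n + diag (G ∘ suc) n) - D + diag R n
        ≡⟨ cong (λ x → E + (x + x) - D + diag R n) (diag-shiftˡ G G₀ n) ⟩
      E + (D₁ + D₁) - D + diag R n ∎

-- The weight `suc k` also falls on entries with first index `k`, whose own weight is `k`. The
-- excess `G k (suc m) - G k m` joins the remainder.
weighted-rec : ∀ (G R : Array) →
  (∀ k m → G (suc k) (suc m) ≡ G k (suc m) + (G (suc k) m + G (suc k) m) - G k m + R k m) →
  ∀ k m → weighted G (suc k) (suc m) ≡
  weighted G k (suc m) + (weighted G (suc k) m + weighted G (suc k) m) - weighted G k m
  + (G k (suc m) - G k m + + suc k * R k m)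
weighted-rec G R G-rec k m = trans (cong (+ suc k *_) (G-rec k m))
  (expand (+ k) (G k (suc m)) (G (suc k) m) (G k m) (R k m))
  where
  expand : ∀ K a b c r → (+ 1 + K) * (a + (b + b) - c + r) ≡
    K * a + ((+ 1 + K) * b + (+ 1 + K) * b) - K * c + (a - c + (+ 1 + K) * r)
  expand = solve-∀

-- Tallies of the nodes whose sites 0 and 1 are not strong

tally₀ tally₁ : Array
tally₀ k m = + partialSum (λ j → descendants j false false false m) k
tally₁ k m = + partialSum (λ j → descendants j false false true m) k

partialSum-1 : ∀ k → partialSum (λ _ → 1) k ≡ k
partialSum-1 zero    = refl
partialSum-1 (suc k) rewrite partialSum-1 k = +-comm k 1

-- A step of the tally in `k` is the count below one node. Its child at site 0 has the same label
-- and is again such a step, one level less deep; its other children make up a whole tally. Hence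
-- the factor two and the subtracted term.
tally₀-rec : ∀ k m → tally₀ (suc k) (suc m) ≡
  tally₀ k (suc m) + (tally₀ (suc k) m + tally₀ (suc k) m) - tally₀ k m + + 0
tally₀-rec k m = begin
  + (P ℕ.+ (V ℕ.+ (Q ℕ.+ V)))           ≡⟨ pos-+ P _ ⟩
  + P + + (V ℕ.+ (Q ℕ.+ V))
    ≡⟨ cong (λ x → + P + x) (trans (pos-+ V _) (cong (λ x → + V + x) (pos-+ Q V))) ⟩
  + P + (+ V + (+ Q + + V))             ≡⟨ rearrange (+ P) (+ V) (+ Q) ⟩
  + P + ((+ Q + + V) + (+ Q + + V)) - + Q + + 0
    ≡⟨ cong (λ x → + P + (x + x) - + Q + + 0) (pos-+ Q V) ⟨
  + P + (+ (Q ℕ.+ V) + + (Q ℕ.+ V)) - + Q + + 0 ∎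
  where
  P = partialSum (λ j → descendants j false false false (suc m)) k
  Q = partialSum (λ j → descendants j false false false m) k
  V = descendants (suc k) false false false m
  rearrange : ∀ P V Q → P + (V + (Q + V)) ≡ P + ((Q + V) + (Q + V)) - Q + + 0
  rearrange = solve-∀

-- Here the child at site 1 keeps the label, while in the child at site 0 site 1 is no longer
-- active, which contributes a step of `tally₀`.
tally₁-rec : ∀ k m → tally₁ (suc k) (suc m) ≡
  tally₁ k (suc m) + (tally₁ (suc k) m + tally₁ (suc k) m) - tally₁ k m + (tally₀ (suc k) m - tally₀ k m)
tally₁-rec k m = begin
  + (P ℕ.+ (V ℕ.+ (W ℕ.+ (Q ℕ.+ W))))
    ≡⟨ trans (pos-+ P _) (cong (λ x → + P + x) (trans (pos-+ V _) (cong (λ x → + V + x)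
         (trans (pos-+ W _) (cong (λ x → + W + x) (pos-+ Q W)))))) ⟩
  + P + (+ V + (+ W + (+ Q + + W)))
    ≡⟨ rearrange (+ P) (+ V) (+ W) (+ Q) (+ U) ⟩
  + P + ((+ Q + + W) + (+ Q + + W)) - + Q + ((+ U + + V) - + U)
    ≡⟨ cong₂ (λ x y → + P + (x + x) - + Q + (y - + U)) (pos-+ Q W) (pos-+ U V) ⟨
  + P + (+ (Q ℕ.+ W) + + (Q ℕ.+ W)) - + Q + (+ (U ℕ.+ V) - + U) ∎
  where
  P = partialSum (λ j → descendants j false false true (suc m)) k
  Q = partialSum (λ j → descendants j false false true m) k
  U = partialSum (λ j → descendants j false false false m) k
  V = descendants (suc k) false false false m
  W = descendants (suc k) false false true m
  rearrange : ∀ P V W Q U → P + (V + (W + (Q + W))) ≡ P + ((Q + W) + (Q + W)) - Q + ((U + V) - U)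
  rearrange = solve-∀

total₀ moment₀ total₁ moment₁ : ℕ → ℤ
total₀ = diag tally₀
moment₀ = diag (weighted tally₀)
total₁ = diag tally₁
moment₁ = diag (weighted tally₁)

diag-zero : ∀ n → diag (λ _ _ → + 0) n ≡ + 0
diag-zero zero    = refl
diag-zero (suc n) = cong (λ x → + 0 + x) (diag-zero n)

tally₀-0 : ∀ k → tally₀ k 0 ≡ + k
tally₀-0 k = cong +_ (partialSum-1 k)

tally₁-0 : ∀ k → tally₁ k 0 ≡ + k
tally₁-0 k = cong +_ (partialSum-1 k)

L-total₀ : ∀ n → L total₀ n ≡ + 1
L-total₀ n = begin
  L total₀ n
    ≡⟨ L-diag tally₀ (λ _ _ → + 0) (λ _ → refl) tally₀-rec n ⟩
  tally₀ (2 ℕ.+ n) 0 - tally₀ (1 ℕ.+ n) 0 + diag (λ _ _ → + 0) n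
    ≡⟨ cong₂ _+_ (cong₂ _-_ (tally₀-0 (2 ℕ.+ n)) (tally₀-0 (1 ℕ.+ n))) (diag-zero n) ⟩
  + (2 ℕ.+ n) - + (1 ℕ.+ n) + + 0                        ≡⟨ simplify (+ n) ⟩
  + 1                                                    ∎
  where
  simplify : ∀ N → (+ 2 + N) - (+ 1 + N) + + 0 ≡ + 1
  simplify = solve-∀

L-moment₀ : ∀ n → L moment₀ n ≡ + (2 ℕ.+ n) + total₀ (suc n) - total₀ n
L-moment₀ n = begin
  L moment₀ n
    ≡⟨ L-diag (weighted tally₀) _ (λ _ → refl) (weighted-rec tally₀ (λ _ _ → + 0) tally₀-rec) n ⟩
  + (2 ℕ.+ n) * tally₀ (2 ℕ.+ n) 0 - + (1 ℕ.+ n) * tally₀ (1 ℕ.+ n) 0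
    + diag (λ k m → tally₀ k (suc m) - tally₀ k m + + suc k * + 0) n
    ≡⟨ cong₂ _+_ (cong₂ (λ x y → + (2 ℕ.+ n) * x - + (1 ℕ.+ n) * y)
         (tally₀-0 (2 ℕ.+ n)) (tally₀-0 (1 ℕ.+ n))) diag-R ⟩
  + (2 ℕ.+ n) * + (2 ℕ.+ n) - + (1 ℕ.+ n) * + (1 ℕ.+ n) + (total₀ (suc n) - + suc n - total₀ n)
    ≡⟨ simplify (+ n) (total₀ (suc n)) (total₀ n) ⟩
  + (2 ℕ.+ n) + total₀ (suc n) - total₀ n ∎
  where
  simplify : ∀ N a₁ a₀ → (+ 2 + N) * (+ 2 + N) - (+ 1 + N) * (+ 1 + N) + (a₁ - (+ 1 + N) - a₀) ≡ (+ 2 + N) + a₁ - a₀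
  simplify = solve-∀

  diag-R : diag (λ k m → tally₀ k (suc m) - tally₀ k m + + suc k * + 0) n ≡ total₀ (suc n) - + suc n - total₀ n
  diag-R = begin
    diag (λ k m → tally₀ k (suc m) - tally₀ k m + + suc k * + 0) n
      ≡⟨ diag-cong (λ k m → trans (cong (λ x → tally₀ k (suc m) - tally₀ k m + x) (ℤ.*-zeroʳ (+ suc k))) (ℤ.+-identityʳ _)) n ⟩
    diag (λ k m → tally₀ k (suc m) - tally₀ k m) n
      ≡⟨ diag-stepʳ tally₀ n ⟩
    total₀ (suc n) - tally₀ (suc n) 0 - total₀ n
      ≡⟨ cong (λ x → total₀ (suc n) - x - total₀ n) (tally₀-0 (suc n)) ⟩
    total₀ (suc n) - + suc n - total₀ n ∎

L-total₁ : ∀ n → L total₁ n ≡ + 1 + total₀ (suc n) - total₀ n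
L-total₁ n = begin
  L total₁ n
    ≡⟨ L-diag tally₁ _ (λ _ → refl) tally₁-rec n ⟩
  tally₁ (2 ℕ.+ n) 0 - tally₁ (1 ℕ.+ n) 0 + diag (λ k m → tally₀ (suc k) m - tally₀ k m) n
    ≡⟨ cong₂ _+_ (cong₂ _-_ (tally₁-0 (2 ℕ.+ n)) (tally₁-0 (1 ℕ.+ n))) (diag-stepˡ tally₀ (λ _ → refl) n) ⟩
  + (2 ℕ.+ n) - + (1 ℕ.+ n) + (total₀ (suc n) - total₀ n)
    ≡⟨ simplify (+ n) (total₀ (suc n)) (total₀ n) ⟩
  + 1 + total₀ (suc n) - total₀ n ∎
  where
  simplify : ∀ N a₁ a₀ → (+ 2 + N) - (+ 1 + N) + (a₁ - a₀) ≡ + 1 + a₁ - a₀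
  simplify = solve-∀

L-moment₁ : ∀ n → L moment₁ n ≡ + (2 ℕ.+ n) + total₁ (suc n) - total₁ n + moment₀ (suc n) - moment₀ n - total₀ n
L-moment₁ n = begin
  L moment₁ n
    ≡⟨ L-diag (weighted tally₁) _ (λ _ → refl) (weighted-rec tally₁ _ tally₁-rec) n ⟩
  + (2 ℕ.+ n) * tally₁ (2 ℕ.+ n) 0 - + (1 ℕ.+ n) * tally₁ (1 ℕ.+ n) 0 + diag R n
    ≡⟨ cong₂ _+_ (cong₂ (λ x y → + (2 ℕ.+ n) * x - + (1 ℕ.+ n) * y)
         (tally₁-0 (2 ℕ.+ n)) (tally₁-0 (1 ℕ.+ n))) diag-R ⟩
  + (2 ℕ.+ n) * + (2 ℕ.+ n) - + (1 ℕ.+ n) * + (1 ℕ.+ n)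
    + ((total₁ (suc n) - + suc n - total₁ n) + ((moment₀ (suc n) - moment₀ n) - total₀ n))
    ≡⟨ simplify (+ n) (total₁ (suc n)) (total₁ n) (moment₀ (suc n)) (moment₀ n) (total₀ n) ⟩
  + (2 ℕ.+ n) + total₁ (suc n) - total₁ n + moment₀ (suc n) - moment₀ n - total₀ n ∎
  where
  R : Array
  R k m = tally₁ k (suc m) - tally₁ k m + + suc k * (tally₀ (suc k) m - tally₀ k m)

  simplify : ∀ N c₁ c₀ b₁ b₀ a₀ →
    (+ 2 + N) * (+ 2 + N) - (+ 1 + N) * (+ 1 + N) + ((c₁ - (+ 1 + N) - c₀) + ((b₁ - b₀) - a₀))
    ≡ (+ 2 + N) + c₁ - c₀ + b₁ - b₀ - a₀
  simplify = solve-∀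

  -- Summation by parts: each tally receives its own index as weight, so that the weighted terms
  -- telescope and one unweighted `t₀` is left.
  expand : ∀ K t₁ t₀ → (+ 1 + K) * (t₁ - t₀) ≡ ((+ 1 + K) * t₁ - K * t₀) - t₀
  expand = solve-∀

  diag-R : diag R n ≡ (total₁ (suc n) - + suc n - total₁ n) + ((moment₀ (suc n) - moment₀ n) - total₀ n)
  diag-R = begin
    diag R n
      ≡⟨ diag-+ (λ k m → tally₁ k (suc m) - tally₁ k m) (λ k m → + suc k * (tally₀ (suc k) m - tally₀ k m)) n ⟩
    diag (λ k m → tally₁ k (suc m) - tally₁ k m) n + diag (λ k m → + suc k * (tally₀ (suc k) m - tally₀ k m)) n
      ≡⟨ cong₂ _+_
           (trans (diag-stepʳ tally₁ n) (cong (λ x → total₁ (suc n) - x - total₁ n) (tally₁-0 (suc n))))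
           (trans (diag-cong (λ k m → expand (+ k) (tally₀ (suc k) m) (tally₀ k m)) n)
             (trans (diag-- (λ k m → weighted tally₀ (suc k) m - weighted tally₀ k m) tally₀ n)
               (cong (_- total₀ n) (diag-stepˡ (weighted tally₀) (λ _ → refl) n)))) ⟩
    (total₁ (suc n) - + suc n - total₁ n) + ((moment₀ (suc n) - moment₀ n) - total₀ n) ∎

-- The root expressed by totals and moments

one-step-total : ∀ (O H : Array) → (∀ k → O k 0 ≡ + 1) → (∀ k m → O k (suc m) ≡ O (suc k) m + H k m) →
  ∀ m → O 0 (suc m) ≡ + 1 + diag H m
-- Unrolling the recurrence follows the antidiagonal down to level 0, where the last `O` supplies
-- the 1.
one-step-total O H O₀ O₊ zero    = trans (O₊ 0 0) (cong (_+ H 0 0) (O₀ 1))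
one-step-total O H O₀ O₊ (suc m) = begin
  O 0 (2 ℕ.+ m)                               ≡⟨ O₊ 0 (suc m) ⟩
  O 1 (suc m) + H 0 (suc m)
    ≡⟨ cong (_+ H 0 (suc m)) (one-step-total (O ∘ suc) (H ∘ suc) (O₀ ∘ suc) (O₊ ∘ suc) m) ⟩
  + 1 + diag (H ∘ suc) m + H 0 (suc m)        ≡⟨ rearrange (diag (H ∘ suc) m) (H 0 (suc m)) ⟩
  + 1 + (H 0 (suc m) + diag (H ∘ suc) m)      ∎
  where
  rearrange : ∀ x y → + 1 + x + y ≡ + 1 + (y + x)
  rearrange = solve-∀

-- H is reached at column k along k different paths from the corner, whence the weight.
two-step-total : ∀ (Z O H s : Array) → (∀ k → Z k 0 ≡ + 1) → (∀ k → O k 0 ≡ + 1) →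
  (∀ k m → O k (suc m) ≡ O (suc k) m + H k m) →
  (∀ k m → Z k (suc m) ≡ Z (suc k) m + (O (suc k) m + s k m)) →
  ∀ m → Z 0 (suc m) ≡ + (2 ℕ.+ m) + (diag s m + diag (weighted H) m)
two-step-total Z O H s Z₀ O₀ O₊ Z₊ zero    =
  trans (Z₊ 0 0) (trans (cong₂ (λ x y → x + (y + s 0 0)) (Z₀ 1) (O₀ 1)) (rearrange (s 0 0)))
  where
  rearrange : ∀ x → + 1 + (+ 1 + x) ≡ + 2 + (x + + 0)
  rearrange = solve-∀
two-step-total Z O H s Z₀ O₀ O₊ Z₊ (suc m) = begin
  Z 0 (2 ℕ.+ m)
    ≡⟨ Z₊ 0 (suc m) ⟩
  Z 1 (suc m) + (O 1 (suc m) + s₀)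
    ≡⟨ cong₂ (λ x y → x + (y + s₀))
         (two-step-total (Z ∘ suc) (O ∘ suc) (H ∘ suc) (s ∘ suc) (Z₀ ∘ suc) (O₀ ∘ suc) (O₊ ∘ suc) (Z₊ ∘ suc) m)
         (one-step-total (O ∘ suc) (H ∘ suc) (O₀ ∘ suc) (O₊ ∘ suc) m) ⟩
  + (2 ℕ.+ m) + (diag (s ∘ suc) m + diag (weighted (H ∘ suc)) m) + (+ 1 + diag (H ∘ suc) m + s₀)
    ≡⟨ rearrange (+ m) (diag (s ∘ suc) m) (diag (weighted (H ∘ suc)) m) (diag (H ∘ suc) m) s₀ ⟩
  + (3 ℕ.+ m) + ((s₀ + diag (s ∘ suc) m) + (+ 0 + (diag (H ∘ suc) m + diag (weighted (H ∘ suc)) m)))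
    ≡⟨ cong (λ x → + (3 ℕ.+ m) + ((s₀ + diag (s ∘ suc) m) + (+ 0 + x)))
         (trans (sym (diag-+ (H ∘ suc) (weighted (H ∘ suc)) m))
           (diag-cong (λ k m → expand (+ k) (H (suc k) m)) m)) ⟩
  + (3 ℕ.+ m) + ((s₀ + diag (s ∘ suc) m) + (+ 0 + diag (weighted H ∘ suc) m)) ∎
  where
  s₀ = s 0 (suc m)
  rearrange : ∀ M x y z w → (+ 2 + M) + (x + y) + (+ 1 + z + w) ≡ (+ 3 + M) + ((w + x) + (+ 0 + (z + y)))
  rearrange = solve-∀
  expand : ∀ K x → x + K * x ≡ (+ 1 + K) * x
  expand = solve-∀

-- `φ n` is the number of avoiders of length `n + 2`; `ψ` and `χ` are its images under one and two
-- applications of `L`. Each application simplifies the sums involved: `ψ` is free of `moment₁`, and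
-- `χ` involves `total₀` alone.
φ ψ χ : ℕ → ℤ
φ n = + (2 ℕ.+ n) + total₁ n + moment₁ n + moment₀ (suc n) - total₀ (suc n) - moment₀ n
ψ n = total₁ (suc n) - total₁ n + moment₀ (suc n) - moment₀ n + + 2 * total₀ (suc n) - + 2 * total₀ n + + 1
χ n = + 2 * total₀ (suc n) + + 2

-- At a node with all bits true, insertion at 0 keeps the bits, insertion at 1 clears only the
-- first, and both raise `k` by one, as `two-step-total` requires. `H` collects the children of a
-- `false true true` node other than the one at site 1: a step of `tally₀` for site 0, and `tally₁`
-- for the sites from 2 on.
descendants-root : ∀ n → + descendants 0 true true true (suc n) ≡ φ n
descendants-root n = begin
  + descendants 0 true true true (suc n)
    ≡⟨ two-step-total (λ k m → + descendants k true true true m) (λ k m → + descendants k false true true m) H tally₁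
         (λ _ → refl) (λ _ → refl) O₊
         (λ k m → trans (pos-+ (descendants (suc k) true true true m) _)
           (cong (λ x → + descendants (suc k) true true true m + x) (pos-+ (descendants (suc k) false true true m) _))) n ⟩
  + (2 ℕ.+ n) + (total₁ n + diag (weighted H) n)
    ≡⟨ cong (λ x → + (2 ℕ.+ n) + (total₁ n + x)) diag-H ⟩
  + (2 ℕ.+ n) + (total₁ n + (((moment₀ (suc n) - moment₀ n) - total₀ (suc n)) + moment₁ n))
    ≡⟨ rearrange (+ n) (total₁ n) (moment₁ n) (moment₀ (suc n)) (total₀ (suc n)) (moment₀ n) ⟩
  φ n ∎
  where
  H : Array
  H k m = tally₀ (suc k) m - tally₀ k m + tally₁ k m

  O₊ : ∀ k m → + descendants k false true true (suc m) ≡ + descendants (suc k) false true true m + H k m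
  O₊ k m = begin
    + (V ℕ.+ (O ℕ.+ s))         ≡⟨ trans (pos-+ V _) (cong (λ x → + V + x) (pos-+ O s)) ⟩
    + V + (+ O + + s)           ≡⟨ shuffle (+ V) (+ O) (+ s) (+ t) ⟩
    + O + ((+ t + + V) - + t + + s) ≡⟨ cong (λ x → + O + (x - + t + + s)) (pos-+ t V) ⟨
    + O + (+ (t ℕ.+ V) - + t + + s) ∎
    where
    V = descendants (suc k) false false false m
    O = descendants (suc k) false true true m
    s = partialSum (λ j → descendants j false false true m) k
    t = partialSum (λ j → descendants j false false false m) k
    shuffle : ∀ V O s t → V + (O + s) ≡ O + ((t + V) - t + s)
    shuffle = solve-∀

  expand : ∀ K t₁ t₀ s → K * (t₁ - t₀ + s) ≡ (((+ 1 + K) * t₁ - K * t₀) - t₁) + K * s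
  expand = solve-∀

  diag-H : diag (weighted H) n ≡ ((moment₀ (suc n) - moment₀ n) - total₀ (suc n)) + moment₁ n
  diag-H = begin
    diag (weighted H) n
      ≡⟨ diag-cong (λ k m → expand (+ k) (tally₀ (suc k) m) (tally₀ k m) (tally₁ k m)) n ⟩
    diag (λ k m → weighted tally₀ (suc k) m - weighted tally₀ k m - tally₀ (suc k) m + weighted tally₁ k m) n
      ≡⟨ diag-+ (λ k m → weighted tally₀ (suc k) m - weighted tally₀ k m - tally₀ (suc k) m) (weighted tally₁) n ⟩
    diag (λ k m → weighted tally₀ (suc k) m - weighted tally₀ k m - tally₀ (suc k) m) n + moment₁ n
      ≡⟨ cong (_+ moment₁ n) (diag-- (λ k m → weighted tally₀ (suc k) m - weighted tally₀ k m) (tally₀ ∘ suc) n) ⟩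
    diag (λ k m → weighted tally₀ (suc k) m - weighted tally₀ k m) n - diag (tally₀ ∘ suc) n + moment₁ n
      ≡⟨ cong₂ (λ x y → x - y + moment₁ n) (diag-stepˡ (weighted tally₀) (λ _ → refl) n)
           (diag-shiftˡ tally₀ (λ _ → refl) n) ⟩
    (moment₀ (suc n) - moment₀ n) - total₀ (suc n) + moment₁ n ∎

  rearrange : ∀ N c d b₁ a₁ b₀ → (+ 2 + N) + (c + (((b₁ - b₀) - a₁) + d)) ≡ (+ 2 + N) + c + d + b₁ - a₁ - b₀
  rearrange = solve-∀

-- Annihilation by three applications of `L`

unfold-L : ∀ (x : ℕ → ℤ) n {r} → L x n ≡ r → x (2 ℕ.+ n) ≡ + 3 * x (1 ℕ.+ n) - x n + r
unfold-L x n refl = rearrange (x (2 ℕ.+ n)) (x (1 ℕ.+ n)) (x n)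
  where
  rearrange : ∀ x₂ x₁ x₀ → x₂ ≡ + 3 * x₁ - x₀ + (x₂ - + 3 * x₁ + x₀)
  rearrange = solve-∀

L-φ : ∀ n → L φ n ≡ ψ n
L-φ n = begin
  L φ n
    -- `L` sends the affine term `2 + n` of `φ` to `-(3 + n)`.
    ≡⟨ linear (+ n) (a₀ 1) (a₀ 2) (a₀ 3) (b₀ 0) (b₀ 1) (b₀ 2) (b₀ 3) (c₀ 0) (c₀ 1) (c₀ 2) (d₀ 0) (d₀ 1) (d₀ 2) ⟩
  L total₁ n + L moment₁ n + L moment₀ (suc n) - L total₀ (suc n) - L moment₀ n - + (3 ℕ.+ n)
    ≡⟨ cong (_- + (3 ℕ.+ n)) (cong₂ _-_ (cong₂ _-_ (cong₂ _+_ (cong₂ _+_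
         (L-total₁ n) (L-moment₁ n)) (L-moment₀ (suc n))) (L-total₀ (suc n))) (L-moment₀ n)) ⟩
  combined (a₀ 2)
    -- `L-moment₀ (suc n)` brings in `total₀ (2 + n)`; its recurrence reduces it to the two values
    -- that occur in `ψ n`.
    ≡⟨ cong combined (unfold-L total₀ n (L-total₀ n)) ⟩
  combined (+ 3 * a₀ 1 - a₀ 0 + + 1)
    ≡⟨ collect (+ n) (a₀ 0) (a₀ 1) (b₀ 0) (b₀ 1) (c₀ 0) (c₀ 1) ⟩
  ψ n ∎
  where
  a₀ b₀ c₀ d₀ : ℕ → ℤ
  a₀ i = total₀ (i ℕ.+ n)
  b₀ i = moment₀ (i ℕ.+ n)
  c₀ i = total₁ (i ℕ.+ n)
  d₀ i = moment₁ (i ℕ.+ n)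

  combined : ℤ → ℤ
  combined a₂ = (+ 1 + a₀ 1 - a₀ 0) + (+ (2 ℕ.+ n) + c₀ 1 - c₀ 0 + b₀ 1 - b₀ 0 - a₀ 0)
    + (+ (3 ℕ.+ n) + a₂ - a₀ 1) - + 1 - (+ (2 ℕ.+ n) + a₀ 1 - a₀ 0) - + (3 ℕ.+ n)

  linear : ∀ N a₁ a₂ a₃ b₀ b₁ b₂ b₃ c₀ c₁ c₂ d₀ d₁ d₂ →
    ((+ 4 + N) + c₂ + d₂ + b₃ - a₃ - b₂) - + 3 * ((+ 3 + N) + c₁ + d₁ + b₂ - a₂ - b₁)
      + ((+ 2 + N) + c₀ + d₀ + b₁ - a₁ - b₀)
    ≡ (c₂ - + 3 * c₁ + c₀) + (d₂ - + 3 * d₁ + d₀) + (b₃ - + 3 * b₂ + b₁) - (a₃ - + 3 * a₂ + a₁)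
      - (b₂ - + 3 * b₁ + b₀) - (+ 3 + N)
  linear = solve-∀

  collect : ∀ N a₀ a₁ b₀ b₁ c₀ c₁ →
    (+ 1 + a₁ - a₀) + ((+ 2 + N) + c₁ - c₀ + b₁ - b₀ - a₀) + ((+ 3 + N) + (+ 3 * a₁ - a₀ + + 1) - a₁)
      - + 1 - ((+ 2 + N) + a₁ - a₀) - (+ 3 + N)
    ≡ c₁ - c₀ + b₁ - b₀ + + 2 * a₁ - + 2 * a₀ + + 1
  collect = solve-∀

L-ψ : ∀ n → L ψ n ≡ χ n
L-ψ n = begin
  L ψ n
    ≡⟨ linear (a₀ 0) (a₀ 1) (a₀ 2) (a₀ 3) (b₀ 0) (b₀ 1) (b₀ 2) (b₀ 3) (c₀ 0) (c₀ 1) (c₀ 2) (c₀ 3) ⟩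
  L total₁ (suc n) - L total₁ n + L moment₀ (suc n) - L moment₀ n + + 2 * L total₀ (suc n) - + 2 * L total₀ n - + 1
    ≡⟨ cong (_- + 1) (cong₂ _-_ (cong₂ _+_ (cong₂ _-_ (cong₂ _+_ (cong₂ _-_
         (L-total₁ (suc n)) (L-total₁ n)) (L-moment₀ (suc n))) (L-moment₀ n))
         (cong (+ 2 *_) (L-total₀ (suc n)))) (cong (+ 2 *_) (L-total₀ n))) ⟩
  combined (a₀ 2)
    ≡⟨ cong combined (unfold-L total₀ n (L-total₀ n)) ⟩
  combined (+ 3 * a₀ 1 - a₀ 0 + + 1)
    ≡⟨ collect (+ n) (a₀ 0) (a₀ 1) ⟩
  χ n ∎
  where
  a₀ b₀ c₀ : ℕ → ℤ
  a₀ i = total₀ (i ℕ.+ n)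
  b₀ i = moment₀ (i ℕ.+ n)
  c₀ i = total₁ (i ℕ.+ n)

  combined : ℤ → ℤ
  combined a₂ = (+ 1 + a₂ - a₀ 1) - (+ 1 + a₀ 1 - a₀ 0) + (+ (3 ℕ.+ n) + a₂ - a₀ 1)
    - (+ (2 ℕ.+ n) + a₀ 1 - a₀ 0) + + 2 - + 2 - + 1

  linear : ∀ a₀ a₁ a₂ a₃ b₀ b₁ b₂ b₃ c₀ c₁ c₂ c₃ →
    (c₃ - c₂ + b₃ - b₂ + + 2 * a₃ - + 2 * a₂ + + 1) - + 3 * (c₂ - c₁ + b₂ - b₁ + + 2 * a₂ - + 2 * a₁ + + 1)
      + (c₁ - c₀ + b₁ - b₀ + + 2 * a₁ - + 2 * a₀ + + 1)
    ≡ (c₃ - + 3 * c₂ + c₁) - (c₂ - + 3 * c₁ + c₀) + (b₃ - + 3 * b₂ + b₁) - (b₂ - + 3 * b₁ + b₀)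
      + + 2 * (a₃ - + 3 * a₂ + a₁) - + 2 * (a₂ - + 3 * a₁ + a₀) - + 1
  linear = solve-∀

  collect : ∀ N a₀ a₁ →
    (+ 1 + (+ 3 * a₁ - a₀ + + 1) - a₁) - (+ 1 + a₁ - a₀) + ((+ 3 + N) + (+ 3 * a₁ - a₀ + + 1) - a₁)
      - ((+ 2 + N) + a₁ - a₀) + + 2 - + 2 - + 1
    ≡ + 2 * a₁ + + 2
  collect = solve-∀

L-χ : ∀ n → L χ n ≡ + 0
L-χ n = trans (linear (total₀ (3 ℕ.+ n)) (total₀ (2 ℕ.+ n)) (total₀ (1 ℕ.+ n)))
  (cong (λ x → + 2 * x - + 2) (L-total₀ (suc n)))
  where
  linear : ∀ a₃ a₂ a₁ →
    (+ 2 * a₃ + + 2) - + 3 * (+ 2 * a₂ + + 2) + (+ 2 * a₁ + + 2)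
    ≡ + 2 * (a₃ - + 3 * a₂ + a₁) - + 2
  linear = solve-∀

L³-φ : ∀ n → L (L (L φ)) n ≡ + 0
L³-φ n = trans (L-cong (L-cong L-φ) n) (trans (L-cong L-ψ n) (L-χ n))

-- The power series identity

avoiders : ℕ → ℤ
avoiders zero    = + 1
avoiders (suc n) = + descendants 0 true true true n

F≡avoiders : ∀ n → F n ≡ avoiders n
F≡avoiders zero    = refl
F≡avoiders (suc n) = cong +_ (numAvoiders-suc n)

convolution-cong : ∀ {f g} q n → (∀ m → f m ≡ g m) → ∀ m k → convolution f q n m k ≡ convolution g q n m k
convolution-cong q n eq zero    k = cong (coeff q k *_) (eq 0)
convolution-cong q n eq (suc m) k = cong₂ _+_ (cong (coeff q k *_) (eq (suc m))) (convolution-cong q n eq m (suc k))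

convolution-tail : ∀ f n m k → convolution f denominator n m (7 ℕ.+ k) ≡ + 0
convolution-tail f n zero    k = refl
convolution-tail f n (suc m) k = cong (λ x → + 0 + x) (convolution-tail f n m (suc k))

-- The cube of `baseDen` has the coefficients 1, -9, 30, -45, 30, -9, 1. The index is at least 7 so
-- that after these seven terms the convolution still has a tail, which `convolution-tail` shows to
-- be zero.
denominator-L³ : ∀ f n → mulSeriesPolyCoeff f denominator (6 ℕ.+ suc n) ≡ L (L (L f)) (suc n)
denominator-L³ f n = trans
  (cong (λ x → + 1 * f (7 ℕ.+ n) + (- + 9 * f (6 ℕ.+ n) + (+ 30 * f (5 ℕ.+ n) + (- + 45 * f (4 ℕ.+ n)
    + (+ 30 * f (3 ℕ.+ n) + (- + 9 * f (2 ℕ.+ n) + (+ 1 * f (1 ℕ.+ n) + x)))))))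
    (convolution-tail f (7 ℕ.+ n) n 0))
  (expand (f (1 ℕ.+ n)) (f (2 ℕ.+ n)) (f (3 ℕ.+ n)) (f (4 ℕ.+ n)) (f (5 ℕ.+ n)) (f (6 ℕ.+ n)) (f (7 ℕ.+ n)))
  where
  expand : ∀ f₀ f₁ f₂ f₃ f₄ f₅ f₆ →
    + 1 * f₆ + (- + 9 * f₅ + (+ 30 * f₄ + (- + 45 * f₃ + (+ 30 * f₂ + (- + 9 * f₁ + (+ 1 * f₀ + + 0))))))
    ≡ ((f₆ - + 3 * f₅ + f₄) - + 3 * (f₅ - + 3 * f₄ + f₃) + (f₄ - + 3 * f₃ + f₂))
      - + 3 * ((f₅ - + 3 * f₄ + f₃) - + 3 * (f₄ - + 3 * f₃ + f₂) + (f₃ - + 3 * f₂ + f₁))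
      + ((f₄ - + 3 * f₃ + f₂) - + 3 * (f₃ - + 3 * f₂ + f₁) + (f₂ - + 3 * f₁ + f₀))
  expand = solve-∀

avoiders-series : ∀ n → mulSeriesPolyCoeff avoiders denominator n ≡ coeff numerator n
avoiders-series 0 = refl
avoiders-series 1 = refl
avoiders-series 2 = refl
avoiders-series 3 = refl
avoiders-series 4 = refl
avoiders-series 5 = refl
avoiders-series 6 = refl
avoiders-series 7 = refl
-- `φ` gives the avoiders from length 2 on, so the annihilation reaches the coefficients from index
-- 8 on. The eight before are evaluated with `descendants`.
avoiders-series (suc (suc (suc (suc (suc (suc (suc (suc n)))))))) = begin
  mulSeriesPolyCoeff avoiders denominator (8 ℕ.+ n)  ≡⟨ denominator-L³ avoiders (suc n) ⟩
  L (L (L (avoiders ∘ (2 ℕ.+_)))) n                  ≡⟨ L-cong (L-cong (L-cong descendants-root)) n ⟩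
  L (L (L φ)) n                                      ≡⟨ L³-φ n ⟩
  + 0                                                ∎

theorem3p47 : (n : ℕ) → mulSeriesPolyCoeff F denominator n ≡ coeff numerator n
theorem3p47 n = trans (convolution-cong denominator n F≡avoiders n 0) (avoiders-series n)
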